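{- Let $r>1$ and $n\ge 1$ be integers and let $R$ be a commutative ring with one. For all signed compositions $\mu,\nu$ of $n$, the following identity holds in the group algebra $RG_{r,n}$: $$E_\mu E_\nu=\sum_{d\in\mathscr D_{\mu^+\nu^+}}|T_{ -\mu\cap d(-\nu)}|\,E_{\mu\cap d\nu}.$$
   Context: $G_{r,n}$ is the group with generators $s_0,s_1,\dots,s_{n-1}$ and relations $s_0^r=1$, $s_i^2=1$ ($1\le i\le n-1$), $s_0s_1s_0s_1=s_1s_0s_1s_0$, $s_is_j=s_js_i$ for $|i-j|>1$ ($0\le i,j\le n-1$), and $s_is_{i+1}s_i=s_{i+1}s_is_{i+1}$ ($1\le i\le n-2$); it is the complex reflection group $G(r,1,n)\cong(\mathbb Z/r\mathbb Z)\wr\mathfrak S_n$. The subgroup $\langle s_1,\dots,s_{n-1}\rangle$ is identified with the symmetric group $\mathfrak S_n$ via $s_i\mapsto(i,i+1)$; $\mathfrak S_n$ acts on $\{1,\dots,n\}$ on the right, $i\mapsto i^w$. Put $t_1=s_0$, $t_{i+1}=s_it_is_i$; then $T=\langle t_1,\dots,t_n\rangle\cong(\mathbb Z/r\mathbb Z)^n$ is normal, $t_iw=wt_{i^w}$ for $w\in\mathfrak S_n$, and $G_{r,n}=T\rtimes\mathfrak S_n$. Let $\Pi=\{t_1,\dots,t_n,s_1,\dots,s_{n-1}\}$ and let $\ell(g)$ be the minimal $k$ such that $g$ is a product of $k$ elements of $\Pi$. A signed composition of $n$ is a sequence $\mu=(\mu_1,\dots,\mu_k)$ of nonzero integers with $\sum|\mu_i|=n$;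 put $\mu^+=(|\mu_1|,\dots,|\mu_k|)$ (a composition), $-\mu=(-\mu_1,\dots,-\mu_k)$, $\bar\mu_0=0$, $\bar\mu_i=|\mu_1|+\dots+|\mu_i|$. Let $\Pi_\mu$ consist of all $s_j$ with $\bar\mu_{i-1}<j<\bar\mu_i$ for some $i$, together with all $t_j$ with $\bar\mu_{i-1}<j\le\bar\mu_i$ for some $i$ with $\mu_i>0$. Let $G_\mu=\langle\Pi_\mu\rangle$ and $T_\mu=G_\mu\cap T$. Let $\mathscr E_\mu=\{e\in G_{r,n}:\ell(e)\le\ell(g)\text{ for all }g\in G_\mu e\}$ and $E_\mu=\sum_{e\in\mathscr E_\mu}e\in RG_{r,n}$. For a composition $\lambda$ of $n$, $\mathfrak S_\lambda$ is the corresponding Young subgroup of $\mathfrak S_n$ and $\mathscr D_\lambda$ is the set of minimal-length (Coxeter length) elements of the right cosets $\mathfrak S_\lambda w$; for compositions $\lambda,\nu$ put $\mathscr D_{\lambda\nu}=\mathscr D_\lambda\cap\mathscr D_\nu^{ -1}$ (minimal length $(\mathfrak S_\lambda,\mathfrak S_\nu)$-double coset representatives). For signed compositions $\mu,\nu$ and $d\in\mathscr D_{\mu^+\nu^+}$, the subgroup $G_\mu\cap dG_\nu d^{ -1}$ equals $G_\sigma$ for a unique signed composition $\sigma$, denoted $\mu\cap d\nu$ (note $\mathscr D_{\mu^+\nu^+}=\mathscr D_{(-\mu)^+(-\nu)^+}$, so $-\mu\cap d(-\nu)$ is defined similarly). -}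

module Defs where

open import Data.Nat using (ℕ; zero; suc; _+_; _∸_; _≡ᵇ_; _≤ᵇ_; NonZero)
open import Data.Nat.DivMod using (_%_)
open import Data.Integer using (ℤ; +_; -[1+_]; ∣_∣; -_)
open import Data.List using (List; []; _∷_; map; upTo; replicate; _++_; concatMap;
  cartesianProduct; filterᵇ; deduplicateᵇ; length; foldr)
open import Data.Bool.ListAction using (any; all)
open import Data.List.Relation.Unary.All using (All)
open import Data.Product using (_×_; _,_; proj₁; proj₂)
open import Data.Bool using (Bool; true; false; if_then_else_; _∧_)
open import Relation.Binary.PropositionalEquality using (_≡_; _≢_)
open import Algebra.Bundles using (CommutativeRing)

IsSignedComposition : ℕ → List ℤ → Set
IsSignedComposition n μ = All (λ z → z ≢ + 0) μ × foldr _+_ 0 (map ∣_∣ μ) ≡ n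

plus : List ℤ → List ℕ
plus = map ∣_∣

neg : List ℤ → List ℤ
neg = map -_

isPos : ℤ → Bool
isPos (+ zero)  = false
isPos (+ suc _) = true
isPos -[1+ _ ]  = false

-- Concrete model of G_{r,n} = T ⋊ 𝔖ₙ.
-- An element (c , w) stands for  t₁^{c₀} ⋯ tₙ^{c_{n-1}} · w , where
--   c : list of length n with entries in {0,…,r-1}  (0-based positions),
--   w : list of length n, w[i] = i^w  (0-based), w a permutation.
-- Using tᵢ w = w t_{i^w} one gets
--   (c , w)(c' , w') = (i ↦ c[i] + c'[i^w] mod r ,  i ↦ (i^w)^{w'}).

Elem : Set
Elem = List ℕ × List ℕ

at : List ℕ → ℕ → ℕ
at []       _       = 0
at (x ∷ xs) zero    = x
at (x ∷ xs) (suc k) = at xs k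

eqL : List ℕ → List ℕ → Bool
eqL []       []       = true
eqL (x ∷ xs) (y ∷ ys) = (x ≡ᵇ y) ∧ eqL xs ys
eqL _        _        = false

eqE : Elem → Elem → Bool
eqE (c , w) (c' , w') = eqL c c' ∧ eqL w w'

_∈ᵇ_ : Elem → List Elem → Bool
x ∈ᵇ xs = any (eqE x) xs

allLists : ℕ → ℕ → List (List ℕ)
allLists m zero    = [] ∷ []
allLists m (suc k) = concatMap (λ x → map (x ∷_) (allLists m k)) (upTo m)

module RingSum {c ℓ} (R : CommutativeRing c ℓ) where
  open CommutativeRing R using (Carrier; 0#; 1#) renaming (_+_ to _+R_)
  Σ : List Carrier → Carrier
  Σ = foldr _+R_ 0#
  fromℕ : ℕ → Carrier
  fromℕ zero    = 0#
  fromℕ (suc k) = 1# +R fromℕ k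

module Wreath (r : ℕ) .{{_ : NonZero r}} (n : ℕ) where

  idx : List ℕ
  idx = upTo n

  one : Elem
  one = (replicate n 0 , idx)

  _·_ : Elem → Elem → Elem
  (c , w) · (c' , w') =
    ( map (λ i → (at c i + at c' (at w i)) % r) idx
    , map (λ i → at w' (at w i)) idx )

  -- t_j (1 ≤ j ≤ n), 1-based as in the paper
  t : ℕ → Elem
  t j = (map (λ i → if suc i ≡ᵇ j then 1 % r else 0) idx , idx)

  -- s_j = (j , j+1) (1 ≤ j ≤ n-1), 1-based positions j , j+1
  s : ℕ → Elem
  s j = ( replicate n 0
        , map (λ i → if suc i ≡ᵇ j then suc i else (if i ≡ᵇ j then i ∸ 1 else i)) idx )

  isPerm : List ℕ → Bool
  isPerm w = all (λ i → any (i ≡ᵇ_) w) idx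

  G : List Elem
  G = cartesianProduct (allLists r n) (filterᵇ isPerm (allLists n n))

  inG : Elem → Bool
  inG x = x ∈ᵇ G

  step : List Elem → List Elem → List Elem
  step gens X = deduplicateᵇ eqE (X ++ concatMap (λ g → map (g ·_) gens) X)

  ball : List Elem → ℕ → List Elem
  ball gens zero    = one ∷ []
  ball gens (suc k) = step gens (ball gens k)

  -- ⟨gens⟩ (G is finite, so the generated submonoid is the generated subgroup)
  gen : List Elem → List Elem
  gen gens = ball gens (length G)

  lenFrom : List Elem → Elem → List Elem → ℕ → ℕ → ℕ
  lenFrom gens g X k zero       = k
  lenFrom gens g X k (suc fuel) =
    if g ∈ᵇ X then k else lenFrom gens g (step gens X) (suc k) fuel

  len : List Elem → Elem → ℕ
  len gens g = lenFrom gens g (one ∷ []) 0 (length G)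

  inv : Elem → Elem
  inv g = foldr (λ y acc → if eqE (g · y) one then y else acc) one G

  Π : List Elem
  Π = map (λ i → t (suc i)) idx ++ map (λ i → s (suc i)) (upTo (n ∸ 1))

  ℓ : Elem → ℕ
  ℓ = len Π

  Πsc : ℕ → List ℤ → List Elem
  Πsc o []       = []
  Πsc o (z ∷ zs) =
    map (λ k → s (o + suc k)) (upTo (∣ z ∣ ∸ 1))
    ++ (if isPos z then map (λ k → t (o + suc k)) (upTo ∣ z ∣) else [])
    ++ Πsc (o + ∣ z ∣) zs

  Gμ : List ℤ → List Elem
  Gμ μ = gen (Πsc 0 μ)

  -- subgroups are given by their lists of elements
  -- 𝓔_H = { e ∈ G : ℓ(e) ≤ ℓ(g) for all g ∈ H e }, indicator function
  inℰ : List Elem → Elem → Bool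
  inℰ H e = inG e ∧ all (λ h → ℓ e ≤ᵇ ℓ (h · e)) H

  Sgens : List Elem
  Sgens = map (λ i → s (suc i)) (upTo (n ∸ 1))

  Sn : List Elem
  Sn = gen Sgens

  coxLen : Elem → ℕ
  coxLen = len Sgens

  Ygens : ℕ → List ℕ → List Elem
  Ygens o []       = []
  Ygens o (m ∷ ms) = map (λ k → s (o + suc k)) (upTo (m ∸ 1)) ++ Ygens (o + m) ms

  Young : List ℕ → List Elem
  Young λ′ = gen (Ygens 0 λ′)

  inD : List ℕ → Elem → Bool
  inD λ′ w = all (λ v → coxLen w ≤ᵇ coxLen (v · w)) (Young λ′)

  D : List ℕ → List ℕ → List Elem
  D λ′ ν = filterᵇ (λ w → inD λ′ w ∧ inD ν (inv w)) Sn

  conjMeet : List Elem → Elem → List Elem → List Elem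
  conjMeet H d K = filterᵇ (λ x → (x ∈ᵇ H) ∧ ((inv d · (x · d)) ∈ᵇ K)) G

  isT : Elem → Bool
  isT (c , w) = eqL w idx

  module Alg {c ℓ′} (R : CommutativeRing c ℓ′) where
    open CommutativeRing R using (Carrier; 0#; 1#) renaming (_+_ to _+R_; _*_ to _*R_)
    open RingSum R

    -- elements of RG_{r,n}: coefficient functions (supported on G)
    RG : Set c
    RG = Elem → Carrier

    _⋆_ : RG → RG → RG
    (a ⋆ b) x = Σ (concatMap (λ y → map (λ z → if eqE (y · z) x then a y *R b z else 0#) G) G)

    _⊕_ : RG → RG → RG
    (a ⊕ b) x = a x +R b x

    _•_ : Carrier → RG → RG
    (k • a) x = k *R a x

    zeroRG : RG
    zeroRG _ = 0#

    sumRG : List RG → RG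
    sumRG = foldr _⊕_ zeroRG

    EH : List Elem → RG
    EH H x = if inℰ H x then 1# else 0#

    E : List ℤ → RG
    E μ = EH (Gμ μ)

    -- Σ_{d ∈ 𝓓_{μ⁺ν⁺}} |T_{-μ ∩ d(-ν)}| E_{μ ∩ dν},
    -- where G_{μ ∩ dν} = G_μ ∩ d G_ν d⁻¹ and T_σ = G_σ ∩ T
    RHS : List ℤ → List ℤ → RG
    RHS μ ν = sumRG (map (λ d →
        fromℕ (length (filterᵇ isT (conjMeet (Gμ (neg μ)) d (Gμ (neg ν)))))
          • EH (conjMeet (Gμ μ) d (Gμ ν)))
      (D (plus μ) (plus ν)))

{-# OPTIONS --safe #-}
module Submission where

-- Every length function involved is L(c , w) = Σ cᵢ + inv(w), and (c , w) is minimal in its coset of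
-- G_μ exactly when c vanishes on the positive blocks of μ and w increases on every block.
--
-- The coefficient of x = (a , u) in E_μ E_ν counts the factorizations x = (c , w)(e , v) with both factors
-- minimal. Such a w is recovered from the ν-blocks of its values: since v = u w⁻¹ increases on the
-- ν-blocks, w sorts the positions with values in a given block by u. Sorting them by position instead
-- gives d ∈ 𝓓_{μ⁺ν⁺}, and w increases on the μ-blocks iff d does and u increases on the blocks of μ ∩ dν.
-- For given w the colour cᵢ is 0 if i is positive for μ, it is aᵢ if only w(i) is positive for ν, and it
-- is free if both are negative; the free colours are an element of T_{-μ ∩ d(-ν)}.

open import Algebra.Bundles using (CommutativeRing)
open import Data.Bool using (Bool; true; false; T; if_then_else_; _∧_; not)
open import Data.Bool.Properties using (T?; T-∧)
open import Data.Bool.ListAction using (all)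
open import Data.Empty using (⊥-elim)
open import Data.Integer using (ℤ; -_; ∣_∣)
import Data.Integer as ℤ
open import Data.Integer.Properties using (∣-i∣≡∣i∣)
open import Data.Nat hiding (pred)
open import Data.Nat.Properties
open import Data.Nat.DivMod using (m<n⇒m%n≡m; m%n<n; m%n≤m; %-distribˡ-+; n%n≡0; [m+n]%n≡m%n; m%n%n≡m%n)
open import Data.List using (List; []; _∷_; map; upTo; replicate; _++_; concatMap;
  cartesianProduct; filter; filterᵇ; deduplicateᵇ; length; foldr; applyUpTo)
open import Data.List.Properties using (length-++; length-map; length-upTo; length-replicate; map-++; map-∘)
open import Data.List.Membership.Propositional using (_∈_; find; lose)
open import Data.List.Membership.Propositional.Properties
open import Data.List.Relation.Unary.Any using (here; there)
open import Data.List.Relation.Unary.Any.Properties using (any⁺; any⁻)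
open import Data.List.Relation.Unary.All as All using (All; []; _∷_)
open import Data.List.Relation.Unary.AllPairs using ([]; _∷_)
open import Data.List.Relation.Unary.Unique.Propositional using (Unique)
import Data.List.Relation.Unary.Unique.Propositional.Properties as Uniq
open import Data.Product using (Σ; ∃; _×_; _,_; proj₁; proj₂)
open import Data.Sum using (_⊎_; inj₁; inj₂; map₂)
open import Data.Unit using (⊤; tt)
open import Function using (_∘_; id; Equivalence)
open import Relation.Binary.Definitions using (tri<; tri≈; tri>)
open import Relation.Nullary
open import Relation.Binary.PropositionalEquality
open import Defs

-- The coefficients lie in an arbitrary ring, so both are exhibited as `fromℕ` of lengths of
-- duplicate-free lists, and only these numbers are compared. No bijection is built: a single
-- relation, `Match`, is total and injective in both directions. Subgroups and lengths are defined
-- by breadth-first search cut off after `length G` rounds. Two facts tie them to `L`: a generator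
-- raises `L` by at most one, and every element other than `one` is an element of smaller `L` times
-- a generator. Hence the ball of radius k is the part of the subgroup with `L` at most k. The
-- cut-off is harmless because `L` takes every value from 0 to `L x` inside the subgroup, so `L x`
-- is less than `length G`. Intersections with conjugates are again of this kind, so μ ∩ dν never
-- has to be written out as a signed composition.

-- Counting by injective relations, and lists as finite sets

-- Induction on `xs`: the partner of the head is cut out of `ys`, and injectivity keeps the tail
-- away from it. With a relation in place of a function, the same data can serve for both
-- inequalities between two lengths.
length-≤-by-relation : ∀ {a b r} {A : Set a} {B : Set b} (R : A → B → Set r) {xs : List A} {ys : List B} →
  Unique xs → (∀ {x} → x ∈ xs → ∃ λ y → y ∈ ys × R x y) →
  (∀ {x x′ y} → x ∈ xs → x′ ∈ xs → y ∈ ys → R x y → R x′ y → x ≡ x′) →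
  length xs ≤ length ys
length-≤-by-relation R {[]} _ _ _ = z≤n
length-≤-by-relation R {x ∷ xs} (x∉ ∷ uxs) tot inj with tot (here refl)
... | y , y∈ , Rxy with ∈-∃++ y∈
... | ps , qs , refl = begin
    suc (length xs)              ≤⟨ s≤s (length-≤-by-relation R uxs tot′ inj′) ⟩
    suc (length (ps ++ qs))      ≡⟨ cong suc (length-++ ps) ⟩
    suc (length ps + length qs)  ≡⟨ +-suc (length ps) (length qs) ⟨
    length ps + suc (length qs)  ≡⟨ length-++ ps ⟨
    length (ps ++ y ∷ qs)        ∎
  where
  open ≤-Reasoning
  weaken : ∀ {z} → z ∈ ps ++ qs → z ∈ ps ++ y ∷ qs
  weaken z∈ with ∈-++⁻ ps z∈
  ... | inj₁ p = ∈-++⁺ˡ p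
  ... | inj₂ q = ∈-++⁺ʳ ps (there q)
  tot′ : ∀ {x} → x ∈ xs → ∃ λ y → y ∈ ps ++ qs × R x y
  tot′ {x′} x′∈ with tot (there x′∈)
  ... | z , z∈ , Rx′z with ∈-++⁻ ps z∈
  ... | inj₁ p = z , ∈-++⁺ˡ p , Rx′z
  ... | inj₂ (there q) = z , ∈-++⁺ʳ ps q , Rx′z
  ... | inj₂ (here refl) = ⊥-elim (All.lookup x∉ x′∈ (inj (here refl) (there x′∈) y∈ Rxy Rx′z))
  inj′ : ∀ {x x′ y} → x ∈ xs → x′ ∈ xs → y ∈ ps ++ qs → R x y → R x′ y → x ≡ x′
  inj′ p q s = inj (there p) (there q) (weaken s)

Unique-⊆⇒length-≤ : ∀ {a} {A : Set a} {xs ys : List A} → Unique xs →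
  (∀ {x} → x ∈ xs → x ∈ ys) → length xs ≤ length ys
Unique-⊆⇒length-≤ u sub = length-≤-by-relation _≡_ u (λ x∈ → _ , sub x∈ , refl) λ { _ _ _ refl refl → refl }

-- `key` recovers the index from a member, so different pieces share no member.
Unique-concatMap : ∀ {a b} {A : Set a} {B : Set b} (f : A → List B) (key : B → A) {xs : List A} →
  Unique xs → (∀ x → Unique (f x)) → (∀ x {y} → y ∈ f x → key y ≡ x) → Unique (concatMap f xs)
Unique-concatMap f key {[]} _ _ _ = []
Unique-concatMap f key {x ∷ xs} (x∉ ∷ u) uf kf =
  Uniq.++⁺ (uf x) (Unique-concatMap f key u uf kf) disj
  where
  disj : ∀ {y} → ¬ (y ∈ f x × y ∈ concatMap f xs)
  disj {y} (p , q) with find (∈-concatMap⁻ f {xs = xs} q)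
  ... | x′ , x′∈ , y∈ = All.lookup x∉ x′∈ (trans (sym (kf x p)) (kf x′ y∈))

∈-filterᵇ⁺ : ∀ {a} {A : Set a} (p : A → Bool) {x xs} → x ∈ xs → T (p x) → x ∈ filterᵇ p xs
∈-filterᵇ⁺ p = ∈-filter⁺ (T? ∘ p)

∈-filterᵇ⁻ : ∀ {a} {A : Set a} (p : A → Bool) {x xs} → x ∈ filterᵇ p xs → x ∈ xs × T (p x)
∈-filterᵇ⁻ p = ∈-filter⁻ (T? ∘ p)

T-∧⁺ : ∀ {x y} → T x → T y → T (x ∧ y)
T-∧⁺ p q = Equivalence.from T-∧ (p , q)

T-∧⁻ : ∀ {x y} → T (x ∧ y) → T x × T y
T-∧⁻ = Equivalence.to T-∧

T-all⁺ : ∀ {a} {A : Set a} (p : A → Bool) xs → (∀ {x} → x ∈ xs → T (p x)) → T (all p xs)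
T-all⁺ p [] _ = tt
T-all⁺ p (x ∷ xs) h = T-∧⁺ (h (here refl)) (T-all⁺ p xs (h ∘ there))

T-all⁻ : ∀ {a} {A : Set a} (p : A → Bool) xs → T (all p xs) → ∀ {x} → x ∈ xs → T (p x)
T-all⁻ p (x ∷ xs) h (here refl) = proj₁ (T-∧⁻ h)
T-all⁻ p (x ∷ xs) h (there x∈) = T-all⁻ p xs (proj₂ (T-∧⁻ {p x} h)) x∈

eqL⁻ : ∀ {xs ys} → T (eqL xs ys) → xs ≡ ys
eqL⁻ {[]} {[]} _ = refl
eqL⁻ {x ∷ xs} {y ∷ ys} h with T-∧⁻ {x ≡ᵇ y} h
... | p , q = cong₂ _∷_ (≡ᵇ⇒≡ x y p) (eqL⁻ q)

eqL⁺ : ∀ xs → T (eqL xs xs)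
eqL⁺ [] = tt
eqL⁺ (x ∷ xs) = T-∧⁺ (≡⇒≡ᵇ x x refl) (eqL⁺ xs)

eqE⁻ : ∀ {x y} → T (eqE x y) → x ≡ y
eqE⁻ {c , w} {c′ , w′} h with T-∧⁻ {eqL c c′} h
... | p , q = cong₂ _,_ (eqL⁻ p) (eqL⁻ q)

eqE⁺ : ∀ {x y} → x ≡ y → T (eqE x y)
eqE⁺ {c , w} refl = T-∧⁺ (eqL⁺ c) (eqL⁺ w)

∈ᵇ⁻ : ∀ {x xs} → T (x ∈ᵇ xs) → x ∈ xs
∈ᵇ⁻ {x} {xs} h with find (any⁻ (eqE x) xs h)
... | y , y∈ , e = subst (_∈ xs) (sym (eqE⁻ e)) y∈

∈ᵇ⁺ : ∀ {x xs} → x ∈ xs → T (x ∈ᵇ xs)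
∈ᵇ⁺ {x} x∈ = any⁺ (eqE x) (lose x∈ (eqE⁺ {x} refl))

deduplicateᵇ-Unique : ∀ xs → Unique (deduplicateᵇ eqE xs)
deduplicateᵇ-Unique [] = []
deduplicateᵇ-Unique (x ∷ xs) =
  All.tabulate (λ y∈ x≡y → proj₂ (∈-filter⁻ (λ y → ¬? (T? (eqE x y))) {xs = deduplicateᵇ eqE xs} y∈) (eqE⁺ x≡y))
  ∷ Uniq.filter⁺ (λ y → ¬? (T? (eqE x y))) (deduplicateᵇ-Unique xs)

∈-deduplicateᵇ⁺ : ∀ {x xs} → x ∈ xs → x ∈ deduplicateᵇ eqE xs
∈-deduplicateᵇ⁺ (here refl) = here refl
∈-deduplicateᵇ⁺ {x} {y ∷ xs} (there x∈) with T? (eqE y x)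
... | yes e = here (sym (eqE⁻ e))
... | no ¬e = there (∈-filter⁺ (λ z → ¬? (T? (eqE y z))) (∈-deduplicateᵇ⁺ x∈) ¬e)

∈-deduplicateᵇ⁻ : ∀ {x xs} → x ∈ deduplicateᵇ eqE xs → x ∈ xs
∈-deduplicateᵇ⁻ {xs = xs} = ∈-deduplicate⁻ (λ x y → T? (eqE x y)) xs

∈-allLists⁻ : ∀ {m} k {c} → c ∈ allLists m k → length c ≡ k × (∀ {i} → i < k → at c i < m)
∈-allLists⁻ zero (here refl) = refl , λ ()
∈-allLists⁻ {m} (suc k) c∈ with find (∈-concatMap⁻ (λ x → map (x ∷_) (allLists m k)) {xs = upTo m} c∈)
... | x , x∈ , c∈′ with ∈-map⁻ (x ∷_) c∈′
... | c′ , c′∈ , refl with ∈-allLists⁻ k c′∈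
... | p , q = cong suc p , λ { {zero} _ → ∈-upTo⁻ x∈ ; {suc i} (s≤s i<) → q i< }

∈-allLists⁺ : ∀ {m} k {c} → length c ≡ k → (∀ {i} → i < k → at c i < m) → c ∈ allLists m k
∈-allLists⁺ zero {[]} _ _ = here refl
∈-allLists⁺ {m} (suc k) {x ∷ c} p q = ∈-concatMap⁺ (λ x → map (x ∷_) (allLists m k))
  (lose (∈-upTo⁺ (q z<s)) (∈-map⁺ (x ∷_) (∈-allLists⁺ k (suc-injective p) (q ∘ s<s))))

allLists-Unique : ∀ m k → Unique (allLists m k)
allLists-Unique m zero = [] ∷ []
allLists-Unique m (suc k) =
  Unique-concatMap (λ x → map (x ∷_) (allLists m k)) (λ c → at c 0) (Uniq.upTo⁺ m)
    (λ x → Uniq.map⁺ (λ { refl → refl }) (allLists-Unique m k))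
    λ x y∈ → cong (λ c → at c 0) (proj₂ (proj₂ (∈-map⁻ (x ∷_) y∈)))

at-map-applyUpTo : ∀ (f g : ℕ → ℕ) n {i} → i < n → at (map f (applyUpTo g n)) i ≡ f (g i)
at-map-applyUpTo f g (suc n) {zero} _ = refl
at-map-applyUpTo f g (suc n) {suc i} (s≤s i<) = at-map-applyUpTo f (g ∘ suc) n i<

at-map-upTo : ∀ (f : ℕ → ℕ) n {i} → i < n → at (map f (upTo n)) i ≡ f i
at-map-upTo f = at-map-applyUpTo f id

at-applyUpTo : ∀ (g : ℕ → ℕ) n {i} → i < n → at (applyUpTo g n) i ≡ g i
at-applyUpTo g (suc n) {zero} _ = refl
at-applyUpTo g (suc n) {suc i} (s≤s i<) = at-applyUpTo (g ∘ suc) n i<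

at-upTo : ∀ n {i} → i < n → at (upTo n) i ≡ i
at-upTo = at-applyUpTo id

at-replicate-0 : ∀ n i → at (replicate n 0) i ≡ 0
at-replicate-0 zero i = refl
at-replicate-0 (suc n) zero = refl
at-replicate-0 (suc n) (suc i) = at-replicate-0 n i

length-map-upTo : ∀ (f : ℕ → ℕ) n → length (map f (upTo n)) ≡ n
length-map-upTo f n = trans (length-map f (upTo n)) (length-upTo n)

at-ext : ∀ n {xs ys} → length xs ≡ n → length ys ≡ n → (∀ {i} → i < n → at xs i ≡ at ys i) → xs ≡ ys
at-ext zero {[]} {[]} _ _ _ = refl
at-ext (suc n) {x ∷ xs} {y ∷ ys} p q h =
  cong₂ _∷_ (h z<s) (at-ext n (suc-injective p) (suc-injective q) (h ∘ s<s))

∈⇒at : ∀ {x xs} → x ∈ xs → ∃ λ i → i < length xs × at xs i ≡ x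
∈⇒at (here refl) = 0 , z<s , refl
∈⇒at (there x∈) with ∈⇒at x∈
... | i , i< , e = suc i , s<s i< , e

at⇒∈ : ∀ xs {i} → i < length xs → at xs i ∈ xs
at⇒∈ (x ∷ xs) {zero} _ = here refl
at⇒∈ (x ∷ xs) {suc i} (s≤s i<) = there (at⇒∈ xs i<)

-- The transposition of a and suc a, in the form in which Wreath.s tabulates it.
sw : ℕ → ℕ → ℕ
sw a i = if i ≡ᵇ a then suc i else (if i ≡ᵇ suc a then i ∸ 1 else i)

-- The graph of `sw a` as an inductive relation: matching on it replaces the two boolean tests, and
-- values are computed through `SwView-functional`.
data SwView (a : ℕ) : ℕ → ℕ → Set where
  lower : SwView a a (suc a)
  upper : SwView a (suc a) a
  other : ∀ {i} → i ≢ a → i ≢ suc a → SwView a i i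

swView : ∀ a i → SwView a i (sw a i)
swView a i with i ≡ᵇ a in p
... | true rewrite ≡ᵇ⇒≡ i a (subst T (sym p) tt) = lower
... | false with i ≡ᵇ suc a in q
...   | true rewrite ≡ᵇ⇒≡ i (suc a) (subst T (sym q) tt) = upper
...   | false = other (λ e → subst T p (≡⇒≡ᵇ i a e)) (λ e → subst T q (≡⇒≡ᵇ i (suc a) e))

SwView-functional : ∀ {a i j k} → SwView a i j → SwView a i k → j ≡ k
SwView-functional lower lower = refl
SwView-functional lower (other p _) = ⊥-elim (p refl)
SwView-functional upper upper = refl
SwView-functional upper (other _ p) = ⊥-elim (p refl)
SwView-functional (other p _) lower = ⊥-elim (p refl)
SwView-functional (other _ p) upper = ⊥-elim (p refl)
SwView-functional (other _ _) (other _ _) = refl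

SwView-sym : ∀ {a i j} → SwView a i j → SwView a j i
SwView-sym lower = upper
SwView-sym upper = lower
SwView-sym (other p q) = other p q

sw-lower : ∀ a → sw a a ≡ suc a
sw-lower a = SwView-functional (swView a a) lower

sw-upper : ∀ a → sw a (suc a) ≡ a
sw-upper a = SwView-functional (swView a (suc a)) upper

sw-invol : ∀ a i → sw a (sw a i) ≡ i
sw-invol a i = SwView-functional (swView a (sw a i)) (SwView-sym (swView a i))

sw-< : ∀ {a n i} → suc a < n → i < n → sw a i < n
sw-< {a} {n} {i} a< i< with sw a i | swView a i
... | _ | lower = a<
... | _ | upper = <-trans (n<1+n a) a<
... | _ | other _ _ = i<

-- No index lies strictly between `a` and `suc a`, so this is the only pair that the transposition
-- can reverse.
sw-mono-< : ∀ a {i j} → i < j → ¬ (i ≡ a × j ≡ suc a) → sw a i < sw a j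
sw-mono-< a {i} {j} i<j ne with sw a i | swView a i | sw a j | swView a j
... | _ | lower | _ | lower = ⊥-elim (<-irrefl refl i<j)
... | _ | lower | _ | upper = ⊥-elim (ne (refl , refl))
... | _ | lower | _ | other _ q = ≤∧≢⇒< i<j (q ∘ sym)
... | _ | upper | _ | lower = ⊥-elim (<-asym i<j (n<1+n a))
... | _ | upper | _ | upper = ⊥-elim (<-irrefl refl i<j)
... | _ | upper | _ | other _ _ = <-trans (n<1+n a) i<j
... | _ | other _ _ | _ | lower = <-trans i<j (n<1+n a)
... | _ | other p _ | _ | upper = ≤∧≢⇒< (s≤s⁻¹ i<j) p
... | _ | other _ _ | _ | other _ _ = i<j

-- Each step gains at least one. Climbing from 0 gives `i ≤ f i`; climbing from `i` to the last
-- index below `n` leaves no room for `f i` to exceed `i`.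
mono-<⇒id : ∀ n (f : ℕ → ℕ) → (∀ {i} → i < n → f i < n) →
  (∀ {i} → suc i < n → f i < f (suc i)) → ∀ {i} → i < n → f i ≡ i
mono-<⇒id n f f< mono {i} i<n = ≤-antisym le ge
  where
  climb : ∀ j k → j + k < n → f j + k ≤ f (j + k)
  climb j zero _ = ≤-reflexive (trans (+-identityʳ _) (cong f (sym (+-identityʳ j))))
  climb j (suc k) h rewrite +-suc j k | +-suc (f j) k =
    ≤-trans (s≤s (climb j k (<-trans (n<1+n _) h))) (mono h)
  ge : i ≤ f i
  ge = ≤-trans (m≤n+m i (f 0)) (climb 0 i i<n)
  k = n ∸ suc i
  i+k : suc (i + k) ≡ n
  i+k = m+[n∸m]≡n i<n
  le : f i ≤ i
  le = +-cancelʳ-≤ k (f i) i (≤-trans (climb i k (≤-reflexive i+k))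
         (s≤s⁻¹ (subst (f (i + k) <_) (sym i+k) (f< (≤-reflexive i+k)))))

-- Permutations of the numbers below `n` and their inversions

module Permutations (n : ℕ) where

  -- Functions on all of ℕ, constrained only below `n`. The inverse is kept as data because its
  -- monotonicity on blocks is itself one of the conditions studied below.
  record IsPerm (f : ℕ → ℕ) : Set where
    field
      from    : ℕ → ℕ
      to<     : ∀ {i} → i < n → f i < n
      from<   : ∀ {i} → i < n → from i < n
      to-from : ∀ {i} → i < n → f (from i) ≡ i
      from-to : ∀ {i} → i < n → from (f i) ≡ i

    injective : ∀ {i j} → i < n → j < n → f i ≡ f j → i ≡ j
    injective i< j< e = trans (sym (from-to i<)) (trans (cong from e) (from-to j<))

  open IsPerm public

  id-perm : IsPerm id
  id-perm = record { from = id ; to< = id ; from< = id ; to-from = λ _ → refl ; from-to = λ _ → refl }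

  inverse : ∀ {f} (p : IsPerm f) → IsPerm (from p)
  inverse {f} p = record { from = f ; to< = from< p ; from< = to< p ; to-from = from-to p ; from-to = to-from p }

  infixr 9 _∘ₚ_
  _∘ₚ_ : ∀ {f g} → IsPerm f → IsPerm g → IsPerm (f ∘ g)
  _∘ₚ_ {f} {g} p q = record
    { from = from q ∘ from p
    ; to< = to< p ∘ to< q
    ; from< = from< q ∘ from< p
    ; to-from = λ i< → trans (cong f (to-from q (from< p i<))) (to-from p i<)
    ; from-to = λ i< → trans (cong (from q) (from-to p (to< q i<))) (from-to q i<) }

  perm-cong : ∀ {f g} → (∀ {i} → i < n → f i ≡ g i) → IsPerm f → IsPerm g
  perm-cong e p = record
    { from = from p
    ; to< = λ i< → subst (_< n) (e i<) (to< p i<)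
    ; from< = from< p
    ; to-from = λ i< → trans (sym (e (from< p i<))) (to-from p i<)
    ; from-to = λ i< → trans (cong (from p) (sym (e i<))) (from-to p i<) }

  sw-perm : ∀ {a} → suc a < n → IsPerm (sw a)
  sw-perm {a} a< = record { from = sw a ; to< = sw-< a< ; from< = sw-< a<
                          ; to-from = λ _ → sw-invol a _ ; from-to = λ _ → sw-invol a _ }

  -- Pigeonhole: if `g (f i)` differed from `i`, then `i` would lie outside the image of `g`, and
  -- together with the `n` distinct values of `g` it would make `n + 1` numbers below `n`.
  surjective⇒perm : ∀ {f} → (∀ {i} → i < n → f i < n) → (g : ℕ → ℕ) →
    (∀ {i} → i < n → g i < n) → (∀ {i} → i < n → f (g i) ≡ i) → IsPerm f
  surjective⇒perm {f} f< g g< fg = record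
    { from = g ; to< = f< ; from< = g< ; to-from = fg ; from-to = gf }
    where
    gf : ∀ {i} → i < n → g (f i) ≡ i
    gf {i} i< with g (f i) ≟ i
    ... | yes e = e
    ... | no ne = ⊥-elim (<-irrefl refl (subst₂ _≤_ (cong suc (length-map-upTo g n)) (length-upTo n)
                    (Unique-⊆⇒length-≤ (All.tabulate fresh ∷ g-unique) sub)))
      where
      fresh : ∀ {k} → k ∈ map g (upTo n) → i ≢ k
      fresh k∈ i≡k with ∈-map⁻ g k∈
      ... | j , j∈ , refl = ne (trans (cong g (trans (cong f i≡k) (fg (∈-upTo⁻ j∈)))) (sym i≡k))
      inj-on : ∀ {xs} → (∀ {x} → x ∈ xs → x < n) → Unique xs → Unique (map g xs)
      inj-on {[]} _ _ = []
      inj-on {x ∷ xs} b (x∉ ∷ u) = All.tabulate (λ k∈ e → let j , j∈ , q = ∈-map⁻ g k∈ in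
        All.lookup x∉ j∈ (trans (sym (fg (b (here refl)))) (trans (cong f (trans e q)) (fg (b (there j∈))))))
        ∷ inj-on (b ∘ there) u
      g-unique : Unique (map g (upTo n))
      g-unique = inj-on ∈-upTo⁻ (Uniq.upTo⁺ n)
      sub : ∀ {k} → k ∈ i ∷ map g (upTo n) → k ∈ upTo n
      sub (here refl) = ∈-upTo⁺ i<
      sub (there k∈) with ∈-map⁻ g k∈
      ... | j , j∈ , refl = ∈-upTo⁺ (g< (∈-upTo⁻ j∈))

  Inversion : (ℕ → ℕ) → ℕ × ℕ → Set
  Inversion f (i , j) = i < j × f j < f i

  Inversion? : ∀ f ij → Dec (Inversion f ij)
  Inversion? f (i , j) = (i <? j) ×-dec (f j <? f i)

  inversions : (ℕ → ℕ) → List (ℕ × ℕ)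
  inversions f = filter (Inversion? f) (cartesianProduct (upTo n) (upTo n))

  inv♯ : (ℕ → ℕ) → ℕ
  inv♯ f = length (inversions f)

  inversions-Unique : ∀ f → Unique (inversions f)
  inversions-Unique f = Uniq.filter⁺ (Inversion? f) (Uniq.cartesianProduct⁺ (Uniq.upTo⁺ n) (Uniq.upTo⁺ n))

  ∈-inversions⁺ : ∀ {f i j} → i < j → j < n → f j < f i → (i , j) ∈ inversions f
  ∈-inversions⁺ {f} i<j j< e = ∈-filter⁺ (Inversion? f)
    (∈-cartesianProduct⁺ (∈-upTo⁺ (<-trans i<j j<)) (∈-upTo⁺ j<)) (i<j , e)

  ∈-inversions⁻ : ∀ {f i j} → (i , j) ∈ inversions f → i < j × j < n × f j < f i
  ∈-inversions⁻ {f} ij∈ with ∈-filter⁻ (Inversion? f) ij∈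
  ... | p , i<j , e = i<j , ∈-upTo⁻ (proj₂ (∈-cartesianProduct⁻ (upTo n) (upTo n) p)) , e

  inv♯-cong : ∀ {f g} → (∀ {i} → i < n → f i ≡ g i) → inv♯ f ≡ inv♯ g
  inv♯-cong {f} {g} e = ≤-antisym (half e) (half (sym ∘ e))
    where
    half : ∀ {f g} → (∀ {i} → i < n → f i ≡ g i) → inv♯ f ≤ inv♯ g
    half {f} {g} e = Unique-⊆⇒length-≤ {ys = inversions g} (inversions-Unique f) λ ij∈ →
      let i<j , j< , q = ∈-inversions⁻ {f} ij∈
      in ∈-inversions⁺ {g} i<j j< (subst₂ _<_ (e j<) (e (<-trans i<j j<)) q)

  -- Applying `sw a` to both entries embeds the inversions of `f ∘ sw a` into those of `f`, and the
  -- inversion `(a , suc a)` of `f` is outside the image.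
  inv♯-swap-positions : ∀ {f a} → suc a < n → f (suc a) < f a → inv♯ (f ∘ sw a) < inv♯ f
  inv♯-swap-positions {f} {a} a< desc =
    subst (_≤ inv♯ f) (cong suc (length-map φ (inversions (f ∘ sw a))))
      (Unique-⊆⇒length-≤ (All.tabulate fresh ∷ Uniq.map⁺ φ-inj (inversions-Unique (f ∘ sw a))) sub)
    where
    φ : ℕ × ℕ → ℕ × ℕ
    φ (i , j) = sw a i , sw a j
    φ-inj : ∀ {x y} → φ x ≡ φ y → x ≡ y
    φ-inj e = cong₂ _,_ (sw-inj (cong proj₁ e)) (sw-inj (cong proj₂ e))
      where
      sw-inj : ∀ {i j} → sw a i ≡ sw a j → i ≡ j
      sw-inj {i} {j} e = trans (sym (sw-invol a i)) (trans (cong (sw a) e) (sw-invol a j))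
    fresh : ∀ {x} → x ∈ map φ (inversions (f ∘ sw a)) → (a , suc a) ≢ x
    fresh x∈ e with ∈-map⁻ φ x∈
    ... | (i , j) , ij∈ , refl = <-asym (proj₁ (∈-inversions⁻ ij∈))
      (subst₂ _<_ (back (cong proj₂ e) (sw-upper a)) (back (cong proj₁ e) (sw-lower a)) (n<1+n a))
      where
      back : ∀ {k l m} → k ≡ sw a l → sw a k ≡ m → m ≡ l
      back {l = l} p q = trans (sym q) (trans (cong (sw a) p) (sw-invol a l))
    sub : ∀ {x} → x ∈ (a , suc a) ∷ map φ (inversions (f ∘ sw a)) → x ∈ inversions f
    sub (here refl) = ∈-inversions⁺ (n<1+n a) a< desc
    sub (there x∈) with ∈-map⁻ φ x∈
    ... | (i , j) , ij∈ , refl = let i<j , j< , q = ∈-inversions⁻ ij∈ in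
      ∈-inversions⁺ (sw-mono-< a i<j (λ { (refl , refl) →
          <-asym desc (subst₂ _<_ (cong f (sw-upper a)) (cong f (sw-lower a)) q) }))
        (sw-< a< j<) q

  module _ {f : ℕ → ℕ} (p : IsPerm f) {a : ℕ} (a< : suc a < n) where

    private
      a<′ : a < n
      a<′ = <-trans (n<1+n a) a<

      -- The values `a` and `suc a` are adjacent, so exchanging them affects the order only at the
      -- two positions where they are attained.
      inversion-swap-values : ∀ {i j} → (i , j) ∈ inversions (sw a ∘ f) →
        (i , j) ∈ inversions f ⊎ (i ≡ from p a × j ≡ from p (suc a))
      inversion-swap-values {i} {j} ij∈ with ∈-inversions⁻ ij∈
      ... | i<j , j< , q with f j <? f i
      ...   | yes e = inj₁ (∈-inversions⁺ i<j j< e)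
      ...   | no ¬e with (f i ≟ a) ×-dec (f j ≟ suc a)
      ...     | yes (refl , e) = inj₂ (sym (from-to p (<-trans i<j j<)) , trans (sym (from-to p j<)) (cong (from p) e))
      ...     | no ne = ⊥-elim (<-asym q (sw-mono-< a
                  (≤∧≢⇒< (≮⇒≥ ¬e) (<⇒≢ i<j ∘ injective p (<-trans i<j j<) j<)) ne))

    inv♯-swap-values-≤ : inv♯ (sw a ∘ f) ≤ suc (inv♯ f)
    inv♯-swap-values-≤ = Unique-⊆⇒length-≤ {ys = (from p a , from p (suc a)) ∷ inversions f}
      (inversions-Unique (sw a ∘ f)) sub
      where
      sub : ∀ {x} → x ∈ inversions (sw a ∘ f) → x ∈ (from p a , from p (suc a)) ∷ inversions f
      sub x∈ with inversion-swap-values x∈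
      ... | inj₁ y = there y
      ... | inj₂ (refl , refl) = here refl

    inv♯-swap-values-< : from p (suc a) < from p a → inv♯ (sw a ∘ f) < inv♯ f
    inv♯-swap-values-< desc = Unique-⊆⇒length-≤ {xs = (from p (suc a) , from p a) ∷ inversions (sw a ∘ f)}
      (All.tabulate fresh ∷ inversions-Unique (sw a ∘ f)) sub
      where
      fresh : ∀ {x} → x ∈ inversions (sw a ∘ f) → (from p (suc a) , from p a) ≢ x
      fresh x∈ refl = <-asym (n<1+n a) (subst₂ _<_
        (trans (cong (sw a) (to-from p a<′)) (sw-lower a))
        (trans (cong (sw a) (to-from p a<)) (sw-upper a)) (proj₂ (proj₂ (∈-inversions⁻ x∈))))
      sub : ∀ {x} → x ∈ (from p (suc a) , from p a) ∷ inversions (sw a ∘ f) → x ∈ inversions f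
      sub (here refl) = ∈-inversions⁺ desc (from< p a<′)
        (subst₂ _<_ (sym (to-from p a<′)) (sym (to-from p a<)) (n<1+n a))
      sub (there x∈) with inversion-swap-values x∈
      ... | inj₁ y = y
      ... | inj₂ (refl , refl) = ⊥-elim (<-asym desc (proj₁ (∈-inversions⁻ x∈)))

-- Block structures and functions increasing on blocks

module Shapes (n : ℕ) where
  open Permutations n

  -- The data μ of a reflection subgroup G_μ: the blocks are the classes of _~_, the positive
  -- blocks those on which Sg holds.
  record Shape : Set₁ where
    field
      _~_      : ℕ → ℕ → Set
      ~-refl   : ∀ {i} → i ~ i
      ~-sym    : ∀ {i j} → i ~ j → j ~ i
      ~-trans  : ∀ {i j k} → i ~ j → j ~ k → i ~ k
      _~?_     : ∀ i j → Dec (i ~ j)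
      ~-convex : ∀ {i j k} → i ≤ k → k ≤ j → j < n → i ~ j → i ~ k
      Sg       : ℕ → Set
      Sg?      : ∀ i → Dec (Sg i)
      Sg-cong  : ∀ {i j} → i < n → j < n → i ~ j → Sg i → Sg j

  module Blocks (S : Shape) where
    open Shape S

    Increasing : (ℕ → ℕ) → Set
    Increasing f = ∀ {i} → suc i < n → i ~ suc i → f i < f (suc i)

    Preserving : (ℕ → ℕ) → Set
    Preserving f = ∀ {i} → i < n → f i ~ i

    Increasing-cong : ∀ {f g} → (∀ {i} → i < n → f i ≡ g i) → Increasing f → Increasing g
    Increasing-cong e inc {i} i< i~ = subst₂ _<_ (e (<-trans (n<1+n i) i<)) (e i<) (inc i< i~)

    increasing-on-block : ∀ {f} → Increasing f → ∀ {i j} → i < j → j < n → i ~ j → f i < f j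
    increasing-on-block {f} inc {i} {suc j} (s≤s i≤j) j< i~j with m≤n⇒m<n∨m≡n i≤j
    ... | inj₂ refl = inc j< i~j
    ... | inj₁ i<j = <-trans (increasing-on-block inc i<j (<-trans (n<1+n j) j<) i~j′)
                       (inc j< (~-trans (~-sym i~j′) i~j))
      where
      i~j′ : i ~ j
      i~j′ = ~-convex i≤j (n≤1+n j) j< i~j

    increasing-reflects-< : ∀ {f} → Increasing f → ∀ {i j} → i < n → j < n → i ~ j → f i < f j → i < j
    increasing-reflects-< {f} inc {i} {j} i< j< i~j e with <-cmp i j
    ... | tri< lt _ _ = lt
    ... | tri≈ _ refl _ = ⊥-elim (<-irrefl refl e)
    ... | tri> _ _ gt = ⊥-elim (<-asym e (increasing-on-block inc gt i< (~-sym i~j)))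

    -- Blocks are intervals: otherwise one of the two blocks would reach across into the other, and
    -- convexity would put `i` and `j` in the same block.
    blocks-ordered : ∀ {i j i′ j′} → i < j → j < n → i′ < n → j′ < n → ¬ i ~ j → i′ ~ i → j′ ~ j → i′ < j′
    blocks-ordered {i} {j} {i′} {j′} i<j j< i′< j′< ne i′~i j′~j with i′ <? j′ | i′ <? j
    ... | yes lt | _ = lt
    ... | no ge | yes i′<j = ⊥-elim (ne (~-trans (~-sym i′~i) (~-trans
            (~-sym (~-convex (≮⇒≥ ge) (<⇒≤ i′<j) j< j′~j)) j′~j)))
    ... | no ge | no i′≥j = ⊥-elim (ne (~-convex (<⇒≤ i<j) (≮⇒≥ i′≥j) i′< (~-sym i′~i)))

    Preserving-inverse : ∀ {h} (p : IsPerm h) → Preserving h → Preserving (from p)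
    Preserving-inverse {h} p pres {i} i< =
      subst (from p i ~_) (to-from p i<) (~-sym (pres (from< p i<)))

    -- Inside a block `h` increases by assumption, and between blocks because it keeps each block in
    -- place; so it increases everywhere.
    increasing-preserving⇒id : ∀ {h} → IsPerm h → Preserving h → Increasing h → ∀ {i} → i < n → h i ≡ i
    increasing-preserving⇒id {h} p pres inc = mono-<⇒id n h (to< p) step
      where
      step : ∀ {i} → suc i < n → h i < h (suc i)
      step {i} i< with i ~? suc i
      ... | yes i~ = inc i< i~
      ... | no ne = blocks-ordered (n<1+n i) i< (to< p i<′) (to< p i<) ne (pres i<′) (pres i<)
        where
        i<′ : i < n
        i<′ = <-trans (n<1+n i) i<

    -- On blocks `f′` also reflects the order, so `k` inherits monotonicity from `f′ ∘ k = f`. Hence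
    -- a coset of the block-preserving permutations contains only one increasing function.
    increasing-representative-unique : ∀ {f f′ k} → Increasing f → Increasing f′ → IsPerm k → Preserving k →
      (∀ {i} → i < n → f′ (k i) ≡ f i) → ∀ {i} → i < n → k i ≡ i
    increasing-representative-unique {f} {f′} {k} inc inc′ p pres e =
      increasing-preserving⇒id p pres λ {i} i< i~ →
        let i<′ = <-trans (n<1+n i) i<
        in increasing-reflects-< inc′ (to< p i<′) (to< p i<)
             (~-trans (pres i<′) (~-trans i~ (~-sym (pres i<))))
             (subst₂ _<_ (sym (e i<′)) (sym (e i<)) (inc i< i~))

    Descent : (ℕ → ℕ) → ℕ → Set
    Descent f i = suc i < n × i ~ suc i × f (suc i) < f i

    Descent? : ∀ f i → Dec (Descent f i)
    Descent? f i = (suc i <? n) ×-dec (i ~? suc i) ×-dec (f (suc i) <? f i)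

    no-descent⇒increasing : ∀ {f} → IsPerm f → ¬ (∃ λ i → i < n × Descent f i) → Increasing f
    no-descent⇒increasing p none {i} i< i~ =
      ≤∧≢⇒< (≮⇒≥ λ desc → none (i , i<′ , i< , i~ , desc)) (<⇒≢ (n<1+n i) ∘ injective p i<′ i<)
      where
      i<′ : i < n
      i<′ = <-trans (n<1+n i) i<

    sw-preserving : ∀ {a} → a ~ suc a → Preserving (sw a)
    sw-preserving {a} a~ {i} _ with sw a i | swView a i
    ... | _ | lower = ~-sym a~
    ... | _ | upper = a~
    ... | _ | other _ _ = ~-refl

    record Sorting (f : ℕ → ℕ) : Set where
      field
        sorter     : ℕ → ℕ
        isPerm     : IsPerm sorter
        preserving : Preserving sorter
        increasing : Increasing (f ∘ sorter)

    -- Bubble sort: an exchange at a descent inside a block lowers the inversion number, and the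
    -- bound `m` makes the recursion structural.
    sort-below : ∀ m {f} → inv♯ f < m → IsPerm f → Sorting f
    sort-below (suc m) {f} (s≤s lt) p with anyUpTo? (Descent? f) n
    ... | no none = record { sorter = id ; isPerm = id-perm ; preserving = λ _ → ~-refl
                           ; increasing = no-descent⇒increasing p none }
    ... | yes (a , _ , a< , a~ , desc) = record
      { sorter = sw a ∘ h.sorter
      ; isPerm = sw-perm a< ∘ₚ h.isPerm
      ; preserving = λ i< → ~-trans (sw-preserving a~ (to< h.isPerm i<)) (h.preserving i<)
      ; increasing = h.increasing }
      where
      module h = Sorting (sort-below m (<-≤-trans (inv♯-swap-positions {f} a< desc) lt) (p ∘ₚ sw-perm a<))

    sort : ∀ {f} → IsPerm f → Sorting f
    sort {f} = sort-below (suc (inv♯ f)) ≤-refl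

    -- An inversion of an increasing `f` joins two different blocks. Since `h` preserves each block,
    -- pulling the pair back along `h` keeps its order and gives an inversion of `f ∘ h`.
    inv♯-increasing-minimal : ∀ {f h} → Increasing f → IsPerm h → Preserving h → inv♯ f ≤ inv♯ (f ∘ h)
    inv♯-increasing-minimal {f} {h} inc p pres =
      length-≤-by-relation (λ (i , j) (i′ , j′) → from p i ≡ i′ × from p j ≡ j′) (inversions-Unique f) tot inj
      where
      tot : ∀ {ij} → ij ∈ inversions f → ∃ λ ij′ → ij′ ∈ inversions (f ∘ h) × (from p (proj₁ ij) ≡ proj₁ ij′ × from p (proj₂ ij) ≡ proj₂ ij′)
      tot {i , j} ij∈ with ∈-inversions⁻ {f} ij∈
      ... | i<j , j< , q = (from p i , from p j) , ∈-inversions⁺ {f ∘ h}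
            (blocks-ordered i<j j< (from< p i<) (from< p j<)
              (λ i~j → <-asym q (increasing-on-block inc i<j j< i~j))
              (Preserving-inverse p pres i<) (Preserving-inverse p pres j<))
            (from< p j<) (subst₂ _<_ (cong f (sym (to-from p j<))) (cong f (sym (to-from p i<))) q) , refl , refl
        where
        i< : i < n
        i< = <-trans i<j j<
      from-inj : ∀ {i i′ k} → i < n → i′ < n → from p i ≡ k → from p i′ ≡ k → i ≡ i′
      from-inj i< i′< e e′ = injective (inverse p) i< i′< (trans e (sym e′))
      inj : ∀ {x x′ y} → x ∈ inversions f → x′ ∈ inversions f → y ∈ inversions (f ∘ h) →
            from p (proj₁ x) ≡ proj₁ y × from p (proj₂ x) ≡ proj₂ y →
            from p (proj₁ x′) ≡ proj₁ y × from p (proj₂ x′) ≡ proj₂ y → x ≡ x′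
      inj x∈ x′∈ _ (e₁ , e₂) (e₁′ , e₂′) with ∈-inversions⁻ {f} x∈ | ∈-inversions⁻ {f} x′∈
      ... | i<j , j< , _ | i′<j′ , j′< , _ =
        cong₂ _,_ (from-inj (<-trans i<j j<) (<-trans i′<j′ j′<) e₁ e₁′) (from-inj j< j′< e₂ e₂′)

    -- The operation behind both directions of the correspondence: within each block of values, the
    -- values are reassigned so that they follow the order of `g` on positions. With `g = id` it
    -- yields the double coset representative, with `g = act x` the left factor.
    resort : ∀ {f g} → IsPerm f → IsPerm g →
      ∃ λ f′ → Σ (IsPerm f′) λ p′ → (∀ {i} → i < n → f′ i ~ f i) × Increasing (g ∘ from p′)
    resort {f} p q = from isPerm ∘ f , inverse isPerm ∘ₚ p ,
      (λ i< → Preserving-inverse isPerm preserving (to< p i<)) , increasing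
      where open Sorting (sort (q ∘ₚ inverse p))

    resort-unique : ∀ {f f′ g} (p : IsPerm f) (p′ : IsPerm f′) → (∀ {i} → i < n → f′ i ~ f i) →
      Increasing (g ∘ from p) → Increasing (g ∘ from p′) → ∀ {i} → i < n → f′ i ≡ f i
    resort-unique {f} {f′} {g} p p′ same inc inc′ {i} i< =
      trans (cong f′ (sym (from-to p i<)))
        (increasing-representative-unique {g ∘ from p} {g ∘ from p′} inc inc′ (p′ ∘ₚ inverse p)
          (λ {j} j< → subst (f′ (from p j) ~_) (to-from p j<) (same (from< p j<)))
          (λ j< → cong g (from-to p′ (from< p j<))) (to< p i<))

  -- Neighbours sent to different blocks of `S₂` compare under `f′` as under `f`; neighbours sent to
  -- the same block compare as under `g`, because `f′` sorts by `g`.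
  transfer-increasing : ∀ (S₁ S₂ : Shape) (let module S₁ = Shape S₁) (let module S₂ = Shape S₂) {f f′ g} →
    IsPerm f → (p′ : IsPerm f′) → (∀ {i} → i < n → f′ i S₂.~ f i) →
    Blocks.Increasing S₁ f → Blocks.Increasing S₂ (g ∘ from p′) →
    (∀ {i} → suc i < n → i S₁.~ suc i → f i S₂.~ f (suc i) → g i < g (suc i)) → Blocks.Increasing S₁ f′
  transfer-increasing S₁ S₂ {f} {f′} {g} p p′ same inc inc′ mono {i} i< i~ with Shape._~?_ S₂ (f i) (f (suc i))
  ... | no ne = Blocks.blocks-ordered S₂ (inc i< i~) (to< p i<) (to< p′ i<′) (to< p′ i<) ne (same i<′) (same i<)
    where
    i<′ : i < n
    i<′ = <-trans (n<1+n i) i<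
  ... | yes fi~ = Blocks.increasing-reflects-< S₂ inc′ (to< p′ i<′) (to< p′ i<)
      (S₂.~-trans (same i<′) (S₂.~-trans fi~ (S₂.~-sym (same i<))))
      (subst₂ _<_ (cong g (sym (from-to p′ i<′))) (cong g (sym (from-to p′ i<))) (mono i< i~ fi~))
    where
    module S₂ = Shape S₂
    i<′ : i < n
    i<′ = <-trans (n<1+n i) i<

-- Elements of the group and the statistic `L`

module Elements (r : ℕ) .{{_ : NonZero r}} (n : ℕ) where
  open Wreath r n public
  open Permutations n public
  open Shapes n public

  col act : Elem → ℕ → ℕ
  col x = at (proj₁ x)
  act x = at (proj₂ x)

  record InG (x : Elem) : Set where
    field
      length-col : length (proj₁ x) ≡ n
      length-act : length (proj₂ x) ≡ n
      col<       : ∀ {i} → i < n → col x i < r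
      perm       : IsPerm (act x)

  open InG public

  %-identity : ∀ {m} → m < r → m % r ≡ m
  %-identity = m<n⇒m%n≡m

  0<r : 0 < r
  0<r = >-nonZero⁻¹ r

  ∈G⁻ : ∀ {x} → x ∈ G → InG x
  ∈G⁻ {c , w} x∈ with ∈-cartesianProduct⁻ (allLists r n) (filterᵇ isPerm (allLists n n)) x∈
  ... | c∈ , w∈ with ∈-allLists⁻ n c∈ | ∈-filterᵇ⁻ isPerm {xs = allLists n n} w∈
  ... | lc , c< | w∈′ , isP with ∈-allLists⁻ n w∈′
  ... | lw , w< = record
    { length-col = lc ; length-act = lw ; col< = c<
    ; perm = surjective⇒perm w< position (proj₁ ∘ position-spec) (proj₂ ∘ position-spec) }
    where
    preimage : ∀ {i} → i < n → ∃ λ k → k < n × at w k ≡ i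
    preimage {i} i< with find (any⁻ (i ≡ᵇ_) w (T-all⁻ _ idx isP (∈-upTo⁺ i<)))
    ... | y , y∈ , e with ∈⇒at y∈
    ... | k , k< , q = k , subst (k <_) lw k< , trans q (sym (≡ᵇ⇒≡ i y e))
    position : ℕ → ℕ
    position i with i <? n
    ... | yes i< = proj₁ (preimage i<)
    -- An arbitrary value outside the range turns the choice of preimages into a total function.
    ... | no _ = 0
    position-spec : ∀ {i} → i < n → position i < n × at w (position i) ≡ i
    position-spec {i} i< with i <? n
    ... | yes i<′ = proj₂ (preimage i<′)
    ... | no ¬i< = ⊥-elim (¬i< i<)

  ∈G⁺ : ∀ {x} → InG x → x ∈ G
  ∈G⁺ {c , w} x∈ = ∈-cartesianProduct⁺ (∈-allLists⁺ n (length-col x∈) (col< x∈))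
    (∈-filterᵇ⁺ isPerm (∈-allLists⁺ n (length-act x∈) (to< (perm x∈)))
      (T-all⁺ _ idx λ {i} i∈ → any⁺ (i ≡ᵇ_) (lose (hit (∈-upTo⁻ i∈)) (≡⇒≡ᵇ i i refl))))
    where
    hit : ∀ {i} → i < n → i ∈ w
    hit i< = subst (_∈ w) (to-from (perm x∈) i<)
      (at⇒∈ w (subst (from (perm x∈) _ <_) (sym (length-act x∈)) (from< (perm x∈) i<)))

  G-Unique : Unique G
  G-Unique = Uniq.cartesianProduct⁺ (allLists-Unique r n) (Uniq.filter⁺ (T? ∘ isPerm) (allLists-Unique n n))

  elem-ext : ∀ {x y} → InG x → InG y → (∀ {i} → i < n → col x i ≡ col y i) →
    (∀ {i} → i < n → act x i ≡ act y i) → x ≡ y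
  elem-ext x∈ y∈ p q = cong₂ _,_ (at-ext n (length-col x∈) (length-col y∈) p)
    (at-ext n (length-act x∈) (length-act y∈) q)

  mk : (ℕ → ℕ) → (ℕ → ℕ) → Elem
  mk c f = map c idx , map f idx

  col-mk : ∀ c f {i} → i < n → col (mk c f) i ≡ c i
  col-mk c f = at-map-upTo c n

  act-mk : ∀ c f {i} → i < n → act (mk c f) i ≡ f i
  act-mk c f = at-map-upTo f n

  mk-InG : ∀ {c f} → (∀ {i} → i < n → c i < r) → IsPerm f → InG (mk c f)
  mk-InG {c} {f} c< p = record
    { length-col = length-map-upTo c n ; length-act = length-map-upTo f n
    ; col< = λ i< → subst (_< r) (sym (col-mk c f i<)) (c< i<)
    ; perm = perm-cong (sym ∘ act-mk c f) p }

  col-· : ∀ x y {i} → i < n → col (x · y) i ≡ (col x i + col y (act x i)) % r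
  col-· x y = at-map-upTo _ n

  act-· : ∀ x y {i} → i < n → act (x · y) i ≡ act y (act x i)
  act-· x y = at-map-upTo _ n

  ·-InG : ∀ {x y} → InG x → InG y → InG (x · y)
  ·-InG x∈ y∈ = mk-InG (λ _ → m%n<n _ r) (perm y∈ ∘ₚ perm x∈)

  col-one : ∀ i → col one i ≡ 0
  col-one = at-replicate-0 n

  act-one : ∀ {i} → i < n → act one i ≡ i
  act-one = at-upTo n

  one-InG : InG one
  one-InG = record
    { length-col = length-replicate n ; length-act = length-upTo n
    ; col< = λ {i} _ → subst (_< r) (sym (col-one i)) 0<r
    ; perm = perm-cong (sym ∘ act-one) id-perm }

  col-s : ∀ j i → col (s j) i ≡ 0
  col-s j = at-replicate-0 n

  act-s : ∀ a {i} → i < n → act (s (suc a)) i ≡ sw a i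
  act-s a = at-map-upTo _ n

  s-InG : ∀ {a} → suc a < n → InG (s (suc a))
  s-InG {a} a< = record
    { length-col = length-replicate n ; length-act = length-map-upTo _ n
    ; col< = λ {i} _ → subst (_< r) (sym (col-s (suc a) i)) 0<r
    ; perm = perm-cong (sym ∘ act-s a) (sw-perm a<) }

  act-t : ∀ j {i} → i < n → act (t j) i ≡ i
  act-t j = at-upTo n

  col-t-here : ∀ {j} → j < n → col (t (suc j)) j ≡ 1 % r
  col-t-here {j} j< = trans (at-map-upTo _ n j<) (go (j ≡ᵇ j) (≡⇒≡ᵇ j j refl))
    where
    go : ∀ b → T b → (if b then 1 % r else 0) ≡ 1 % r
    go true _ = refl

  col-t-there : ∀ {i j} → i < n → i ≢ j → col (t (suc j)) i ≡ 0
  col-t-there {i} {j} i< ne = trans (at-map-upTo _ n i<) (go (i ≡ᵇ j) (ne ∘ ≡ᵇ⇒≡ i j))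
    where
    go : ∀ b → ¬ T b → (if b then 1 % r else 0) ≡ 0
    go true f = ⊥-elim (f tt)
    go false _ = refl

  t-InG : ∀ j → InG (t j)
  t-InG j = record
    { length-col = length-map-upTo _ n ; length-act = length-upTo n
    ; col< = λ {i} i< → subst (_< r) (sym (at-map-upTo _ n i<)) (bound (suc i ≡ᵇ j))
    ; perm = perm-cong (sym ∘ act-t j) id-perm }
    where
    bound : ∀ b → (if b then 1 % r else 0) < r
    bound true = m%n<n 1 r
    bound false = 0<r

  -- The cells of the diagram with row lengths `c i`. Counting cells lets sums of colours be
  -- compared, like inversion numbers, by injections between lists.
  marks : (ℕ → ℕ) → List (ℕ × ℕ)
  marks c = filter (λ (i , k) → k <? c i) (cartesianProduct (upTo n) (upTo r))

  -- For colours below r this is the sum of the c i with i < n.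
  cost : (ℕ → ℕ) → ℕ
  cost c = length (marks c)

  marks-Unique : ∀ c → Unique (marks c)
  marks-Unique c = Uniq.filter⁺ (λ (i , k) → k <? c i) (Uniq.cartesianProduct⁺ (Uniq.upTo⁺ n) (Uniq.upTo⁺ r))

  ∈-marks⁺ : ∀ {c i k} → i < n → k < r → k < c i → (i , k) ∈ marks c
  ∈-marks⁺ {c} i< k< e = ∈-filter⁺ (λ (i , k) → k <? c i) (∈-cartesianProduct⁺ (∈-upTo⁺ i<) (∈-upTo⁺ k<)) e

  ∈-marks⁻ : ∀ {c i k} → (i , k) ∈ marks c → i < n × k < r × k < c i
  ∈-marks⁻ {c} ik∈ with ∈-filter⁻ (λ (i , k) → k <? c i) ik∈
  ... | p , e with ∈-cartesianProduct⁻ (upTo n) (upTo r) p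
  ... | i∈ , k∈ = ∈-upTo⁻ i∈ , ∈-upTo⁻ k∈ , e

  cost-≤-reindexed : ∀ {c c′ h} → IsPerm h → (∀ {i} → i < n → c (h i) ≤ c′ i) → cost c ≤ cost c′
  cost-≤-reindexed {c} {c′} {h} p le =
    length-≤-by-relation (λ (i , k) (i′ , k′) → h i′ ≡ i × k′ ≡ k) (marks-Unique c)
      (λ { {i , k} ik∈ → let i< , k< , e = ∈-marks⁻ {c} ik∈ ; hi = to-from p i< in
           (from p i , k) , ∈-marks⁺ {c′} (from< p i<) k<
             (<-≤-trans e (subst (λ z → c z ≤ c′ (from p i)) hi (le (from< p i<)))) , hi , refl })
      λ { _ _ _ (refl , refl) (refl , refl) → refl }

  cost-mono : ∀ {c c′} → (∀ {i} → i < n → c i ≤ c′ i) → cost c ≤ cost c′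
  cost-mono = cost-≤-reindexed id-perm

  cost-cong : ∀ {c c′} → (∀ {i} → i < n → c i ≡ c′ i) → cost c ≡ cost c′
  cost-cong e = ≤-antisym (cost-mono (≤-reflexive ∘ e)) (cost-mono (≤-reflexive ∘ sym ∘ e))

  cost-increment : ∀ {c c′} j → (∀ {i} → i < n → i ≢ j → c′ i ≤ c i) → c′ j ≤ suc (c j) → cost c′ ≤ suc (cost c)
  cost-increment {c} {c′} j le le₁ = Unique-⊆⇒length-≤ {ys = (j , c j) ∷ marks c} (marks-Unique c′) sub
    where
    sub : ∀ {x} → x ∈ marks c′ → x ∈ (j , c j) ∷ marks c
    sub {i , k} x∈ with ∈-marks⁻ {c′} x∈ | i ≟ j | k <? c i
    ... | i< , k< , e | _ | yes e′ = there (∈-marks⁺ {c} i< k< e′)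
    ... | i< , k< , e | no ne | no ¬e′ = ⊥-elim (¬e′ (<-≤-trans e (le i< ne)))
    ... | i< , k< , e | yes refl | no ¬e′ = here (cong (i ,_) (≤-antisym (s≤s⁻¹ (≤-trans e le₁)) (≮⇒≥ ¬e′)))

  -- The cell `(j , c′ j)` belongs to `c` but not to `c′`. The bound `c j < r` keeps it within the
  -- range of levels that `marks` inspects.
  cost-decrement : ∀ {c c′ j} → (∀ {i} → i < n → c′ i ≤ c i) → j < n → c j < r → c′ j < c j → cost c′ < cost c
  cost-decrement {c} {c′} {j} le j< cj< lt = Unique-⊆⇒length-≤ {xs = (j , c′ j) ∷ marks c′}
    (All.tabulate (λ { x∈ refl → <-irrefl refl (proj₂ (proj₂ (∈-marks⁻ {c′} x∈))) }) ∷ marks-Unique c′) sub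
    where
    sub : ∀ {x} → x ∈ (j , c′ j) ∷ marks c′ → x ∈ marks c
    sub (here refl) = ∈-marks⁺ {c} j< (<-trans lt cj<) lt
    sub (there x∈) with ∈-marks⁻ {c′} x∈
    ... | i< , k< , e = ∈-marks⁺ {c} i< k< (<-≤-trans e (le i<))

  L : Elem → ℕ
  L x = cost (col x) + inv♯ (act x)

  L-one : L one ≡ 0
  L-one = cong₂ _+_
    (n≤0⇒n≡0 (Unique-⊆⇒length-≤ {ys = []} (marks-Unique (col one)) λ { {i , k} x∈ →
      ⊥-elim (n≮0 (subst (k <_) (col-one i) (proj₂ (proj₂ (∈-marks⁻ {col one} x∈))))) }))
    (n≤0⇒n≡0 (Unique-⊆⇒length-≤ {ys = []} (inversions-Unique (act one)) λ { {i , j} x∈ →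
      let i<j , j< , e = ∈-inversions⁻ {act one} x∈
      in ⊥-elim (<-asym i<j (subst₂ _<_ (act-one j<) (act-one (<-trans i<j j<)) e)) }))

  module _ {x : Elem} (x∈ : InG x) where

    col-·t-here : ∀ {i} → i < n → col (x · t (suc (act x i))) i ≡ (col x i + 1 % r) % r
    col-·t-here {i} i< = trans (col-· x (t (suc (act x i))) i<)
      (cong (λ z → (col x i + z) % r) (col-t-here (to< (perm x∈) i<)))

    col-·t-there : ∀ {i j} → i < n → act x i ≢ j → col (x · t (suc j)) i ≡ col x i
    col-·t-there {i} {j} i< ne = trans (col-· x (t (suc j)) i<)
      (trans (cong (λ z → (col x i + z) % r) (col-t-there (to< (perm x∈) i<) ne))
        (trans (cong (_% r) (+-identityʳ _)) (%-identity (col< x∈ i<))))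

    act-·t : ∀ {i} j → i < n → act (x · t j) i ≡ act x i
    act-·t j i< = trans (act-· x (t j) i<) (act-t j (to< (perm x∈) i<))

    col-·s : ∀ {i} j → i < n → col (x · s j) i ≡ col x i
    col-·s {i} j i< = trans (col-· x (s j) i<) (trans (cong (λ z → (col x i + z) % r) (col-s j (act x i)))
      (trans (cong (_% r) (+-identityʳ _)) (%-identity (col< x∈ i<))))

    act-·s : ∀ {i} a → i < n → act (x · s (suc a)) i ≡ sw a (act x i)
    act-·s a i< = trans (act-· x (s (suc a)) i<) (act-s a (to< (perm x∈) i<))

    -- The factor adds 1 modulo `r` to the colour at the position that `x` sends to `j`; wrapping
    -- round to zero only lowers the sum.
    L-·t-≤ : ∀ {j} → j < n → L (x · t (suc j)) ≤ suc (L x)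
    L-·t-≤ {j} j< = +-mono-≤ {x = cost (col (x · t (suc j)))} {suc (cost (col x))}
      (cost-increment {col x} k
        (λ {i} i< ne → ≤-reflexive (col-·t-there i< λ e → ne (trans (sym (from-to p i<)) (cong (from p) e))))
        (subst (λ z → col (x · t (suc z)) k ≤ suc (col x k)) (to-from p j<)
          (≤-trans (≤-reflexive (col-·t-here k<)) (≤-trans (m%n≤m _ r)
            (≤-trans (+-monoʳ-≤ (col x k) (m%n≤m 1 r)) (≤-reflexive (+-comm (col x k) 1)))))))
      (≤-reflexive (inv♯-cong (act-·t (suc j))))
      where
      p = perm x∈
      k = from p j
      k< : k < n
      k< = from< p j<

    L-·s-≤ : ∀ {a} → suc a < n → L (x · s (suc a)) ≤ suc (L x)
    L-·s-≤ {a} a< = subst (L (x · s (suc a)) ≤_) (+-suc (cost (col x)) (inv♯ (act x)))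
      (+-mono-≤ (≤-reflexive (cost-cong (col-·s (suc a))))
        (≤-trans (≤-reflexive (inv♯-cong (act-·s a))) (inv♯-swap-values-≤ (perm x∈) a<)))

upd : ℕ → ℕ → (ℕ → ℕ) → ℕ → ℕ
upd i a c k with k ≟ i
... | yes _ = a
... | no _ = c k

upd-here : ∀ i a c → upd i a c i ≡ a
upd-here i a c with i ≟ i
... | yes _ = refl
... | no ne = ⊥-elim (ne refl)

upd-there : ∀ {i k} a c → k ≢ i → upd i a c k ≡ c k
upd-there {i} {k} a c ne with k ≟ i
... | yes e = ⊥-elim (ne e)
... | no _ = refl

-- The subgroup of a shape: generation, word length, minimal coset elements

module ReflectionSubgroups (r : ℕ) .{{_ : NonZero r}} (n : ℕ) where
  open Elements r n public

  module Subgroup (S : Shape) where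
    open Shape S public
    open Blocks S public

    -- The subgroup described without generators, which makes intersections with conjugates easy to
    -- compute; `gen⁻` and `gen⁺` identify it with the generated one.
    record InH (x : Elem) : Set where
      field
        element        : InG x
        preserving : Preserving (act x)
        col-zero   : ∀ {i} → i < n → ¬ Sg i → col x i ≡ 0

    open InH public

    record GeneratedBy (gens : List Elem) : Set where
      field
        sound : ∀ {π} → π ∈ gens → (∃ λ a → suc a < n × a ~ suc a × π ≡ s (suc a)) ⊎
                                   (∃ λ j → j < n × Sg j × π ≡ t (suc j))
        s∈    : ∀ {a} → suc a < n → a ~ suc a → s (suc a) ∈ gens
        t∈    : ∀ {j} → j < n → Sg j → t (suc j) ∈ gens

    one-InH : InH one
    one-InH = record { element = one-InG
                     ; preserving = λ {i} i< → subst (_~ i) (sym (act-one i<)) ~-refl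
                     ; col-zero = λ _ _ → col-one _ }

    ·-InH : ∀ {x y} → InH x → InH y → InH (x · y)
    ·-InH {x} {y} hx hy = record
      { element = ·-InG (element hx) (element hy)
      ; preserving = λ {i} i< → subst (_~ i) (sym (act-· x y i<))
          (~-trans (preserving hy (to< (perm (element hx)) i<)) (preserving hx i<))
      ; col-zero = λ i< ¬Sg → trans (col-· x y i<) (trans (cong₂ (λ a b → (a + b) % r)
          (col-zero hx i< ¬Sg)
          (col-zero hy (to< (perm (element hx)) i<) (¬Sg ∘ Sg-cong (to< (perm (element hx)) i<) i< (preserving hx i<))))
          (%-identity 0<r)) }

    s-InH : ∀ {a} → suc a < n → a ~ suc a → InH (s (suc a))
    s-InH {a} a< a~ = record
      { element = s-InG a<
      ; preserving = λ {i} i< → subst (_~ i) (sym (act-s a i<)) (sw-preserving a~ i<)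
      ; col-zero = λ {i} _ _ → col-s (suc a) i }

    t-InH : ∀ {j} → j < n → Sg j → InH (t (suc j))
    t-InH {j} j< Sgj = record
      { element = t-InG (suc j)
      ; preserving = λ {i} i< → subst (_~ i) (sym (act-t (suc j) i<)) ~-refl
      ; col-zero = λ {i} i< ¬Sg → col-t-there i< λ { refl → ¬Sg Sgj } }

    module _ {gens : List Elem} (generated : GeneratedBy gens) where
      open GeneratedBy generated

      generator-InH : ∀ {π} → π ∈ gens → InH π
      generator-InH π∈ with sound π∈
      ... | inj₁ (a , a< , a~ , refl) = s-InH a< a~
      ... | inj₂ (j , j< , Sgj , refl) = t-InH j< Sgj

      L-·-generator-≤ : ∀ {x π} → InH x → π ∈ gens → L (x · π) ≤ suc (L x)
      L-·-generator-≤ hx π∈ with sound π∈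
      ... | inj₁ (a , a< , a~ , refl) = L-·s-≤ (element hx) a<
      ... | inj₂ (j , j< , Sgj , refl) = L-·t-≤ (element hx) j<

      record Predecessor (x : Elem) : Set where
        field
          pred       : Elem
          generator  : Elem
          generator∈ : generator ∈ gens
          pred-InH   : InH pred
          product    : x ≡ pred · generator
          pred-<     : L pred < L x

      -- A `t` on the right is indexed by a value of `x`, so lowering the colour at `i` splits off
      -- the `t` belonging to `act x i`. It is among the generators because `act x i` lies in the
      -- block of `i`, which is positive since it carries a colour.
      colour-predecessor : ∀ {x i} → InH x → i < n → 0 < col x i → Predecessor x
      colour-predecessor {x} {i} hx i< pos = record
        { generator∈ = t∈ ai< Sg-ai
        ; pred-InH = record
          { element = gy
          ; preserving = λ {k} k< → subst (_~ k) (sym (act-mk c (act x) k<)) (preserving hx k<)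
          ; col-zero = λ k< ¬Sg → trans (col-mk c (act x) k<)
              (trans (upd-there (col x i ∸ 1) (col x) (λ { refl → ¬Sg Sg-i })) (col-zero hx k< ¬Sg)) }
        ; product = elem-ext gx (·-InG gy (t-InG (suc (act x i)))) product-col
            λ k< → sym (trans (act-·t gy (suc (act x i)) k<) (act-mk c (act x) k<))
        ; pred-< = +-mono-<-≤ {x = cost (col y)} {cost (col x)}
            (cost-decrement {col x} {col y} {i} y≤ i< (col< gx i<) y<)
            (≤-reflexive (inv♯-cong (act-mk c (act x)))) }
        where
        gx = element hx
        c : ℕ → ℕ
        c = upd i (col x i ∸ 1) (col x)
        y = mk c (act x)
        c≤ : ∀ k → c k ≤ col x k
        c≤ k with k ≟ i
        ... | yes refl = m∸n≤m (col x i) 1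
        ... | no _ = ≤-refl
        gy : InG y
        gy = mk-InG (λ {k} k< → ≤-<-trans (c≤ k) (col< gx k<)) (perm gx)
        ai< : act x i < n
        ai< = to< (perm gx) i<
        Sg-i : Sg i
        Sg-i with Sg? i
        ... | yes p = p
        ... | no ¬p = ⊥-elim (<-irrefl (sym (col-zero hx i< ¬p)) pos)
        Sg-ai : Sg (act x i)
        Sg-ai = Sg-cong i< ai< (~-sym (preserving hx i<)) Sg-i
        y≤ : ∀ {k} → k < n → col y k ≤ col x k
        y≤ {k} k< = subst (_≤ col x k) (sym (col-mk c (act x) k<)) (c≤ k)
        col-y-i : col y i ≡ col x i ∸ 1
        col-y-i = trans (col-mk c (act x) i<) (upd-here i (col x i ∸ 1) (col x))
        y< : col y i < col x i
        y< = subst (_< col x i) (sym col-y-i) (∸-monoʳ-< {col x i} z<s pos)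
        1<r : 1 < r
        1<r = ≤-<-trans pos (col< gx i<)
        act-y : ∀ {k} → k < n → act y k ≡ act x k
        act-y = act-mk c (act x)
        product-col : ∀ {k} → k < n → col x k ≡ col (y · t (suc (act x i))) k
        product-col {k} k< with k ≟ i
        ... | yes refl = sym (trans (subst (λ z → col (y · t (suc z)) i ≡ (col y i + 1 % r) % r) (act-y i<)
                (col-·t-here gy i<))
              (trans (cong₂ (λ a b → (a + b) % r) col-y-i (%-identity 1<r))
                (trans (cong (_% r) (m∸n+n≡m pos)) (%-identity (col< gx i<)))))
        ... | no ne = sym (trans (col-·t-there gy k< λ e → ne (injective (perm gx) k< i< (trans (sym (act-y k<)) e)))
              (trans (col-mk c (act x) k<) (upd-there (col x i ∸ 1) (col x) ne)))

      -- Right multiplication by an `s` exchanges values, which is why the descent is taken in the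
      -- inverse permutation.
      descent-predecessor : ∀ {x a} → (hx : InH x) → Descent (from (perm (element hx))) a → Predecessor x
      descent-predecessor {x} {a} hx (a< , a~ , desc) = record
        { generator∈ = s∈ a< a~
        ; pred-InH = record
          { element = gy
          ; preserving = λ {k} k< → subst (_~ k) (sym (act-y k<))
              (~-trans (sw-preserving a~ (to< (perm gx) k<)) (preserving hx k<))
          ; col-zero = λ k< ¬Sg → trans (col-y k<) (col-zero hx k< ¬Sg) }
        ; product = elem-ext gx (·-InG gy (s-InG a<)) (λ k< → sym (trans (col-·s gy (suc a) k<) (col-y k<)))
            λ k< → sym (trans (act-·s gy a k<) (trans (cong (sw a) (act-y k<)) (sw-invol a _)))
        ; pred-< = +-mono-≤-< {x = cost (col y)} {cost (col x)} (≤-reflexive (cost-cong col-y))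
            (≤-<-trans (≤-reflexive (inv♯-cong act-y)) (inv♯-swap-values-< (perm gx) a< desc)) }
        where
        gx = element hx
        y = mk (col x) (sw a ∘ act x)
        gy : InG y
        gy = mk-InG (col< gx) (sw-perm a< ∘ₚ perm gx)
        col-y : ∀ {k} → k < n → col y k ≡ col x k
        col-y = col-mk (col x) (sw a ∘ act x)
        act-y : ∀ {k} → k < n → act y k ≡ sw a (act x k)
        act-y = act-mk (col x) (sw a ∘ act x)

      -- With no colour and no descent of the inverse left, the inverse is increasing and
      -- block-preserving, hence the identity.
      one-or-predecessor : ∀ {x} → InH x → x ≡ one ⊎ Predecessor x
      one-or-predecessor {x} hx with anyUpTo? (λ i → 0 <? col x i) n
      ... | yes (i , i< , pos) = inj₂ (colour-predecessor hx i< pos)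
      ... | no colourless with anyUpTo? (Descent? (from (perm (element hx)))) n
      ...   | yes (a , _ , desc) = inj₂ (descent-predecessor hx desc)
      ...   | no none = inj₁ (elem-ext (element hx) one-InG
                (λ {i} i< → trans (n≤0⇒n≡0 (≮⇒≥ λ pos → colourless (i , i< , pos))) (sym (col-one i)))
                λ {i} i< → trans (trans (cong (act x) (sym (from≗id i<))) (to-from p i<)) (sym (act-one i<)))
        where
        p = perm (element hx)
        from≗id : ∀ {i} → i < n → from p i ≡ i
        from≗id = increasing-preserving⇒id (inverse p) (Preserving-inverse p (preserving hx))
                    (no-descent⇒increasing (inverse p) none)

      step⁻ : ∀ {x X} → x ∈ step gens X → x ∈ X ⊎ (∃ λ y → ∃ λ π → y ∈ X × π ∈ gens × x ≡ y · π)
      step⁻ {x} {X} x∈ with ∈-++⁻ X (∈-deduplicateᵇ⁻ {xs = X ++ _} x∈)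
      ... | inj₁ p = inj₁ p
      ... | inj₂ q with find (∈-concatMap⁻ (λ g → map (g ·_) gens) {xs = X} q)
      ...   | y , y∈ , q′ with ∈-map⁻ (y ·_) q′
      ...     | π , π∈ , e = inj₂ (y , π , y∈ , π∈ , e)

      step⁺ : ∀ {y π X} → y ∈ X → π ∈ gens → y · π ∈ step gens X
      step⁺ {y} {π} {X} y∈ π∈ = ∈-deduplicateᵇ⁺ (∈-++⁺ʳ X
        (∈-concatMap⁺ (λ g → map (g ·_) gens) (lose y∈ (∈-map⁺ (y ·_) π∈))))

      step-⊇ : ∀ {y X} → y ∈ X → y ∈ step gens X
      step-⊇ y∈ = ∈-deduplicateᵇ⁺ (∈-++⁺ˡ y∈)

      ball⁻ : ∀ k {x} → x ∈ ball gens k → InH x × L x ≤ k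
      ball⁻ zero (here refl) = one-InH , ≤-reflexive L-one
      ball⁻ (suc k) x∈ with step⁻ {X = ball gens k} x∈
      ... | inj₁ p = proj₁ (ball⁻ k p) , m≤n⇒m≤1+n (proj₂ (ball⁻ k p))
      ... | inj₂ (y , π , y∈ , π∈ , refl) with ball⁻ k y∈
      ...   | hy , Ly≤ = ·-InH hy (generator-InH π∈) , ≤-trans (L-·-generator-≤ hy π∈) (s≤s Ly≤)

      one∈ball : ∀ k → one ∈ ball gens k
      one∈ball zero = here refl
      one∈ball (suc k) = step-⊇ (one∈ball k)

      -- Each predecessor split off costs one unit of radius and lowers `L` by at least one. With
      -- `ball⁻` this describes the ball completely.
      ball⁺ : ∀ k {x} → InH x → L x ≤ k → x ∈ ball gens k
      ball⁺ k hx le with one-or-predecessor hx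
      ball⁺ k hx le | inj₁ refl = one∈ball k
      ball⁺ zero hx le | inj₂ p = ⊥-elim (n≮0 (≤-trans (Predecessor.pred-< p) le))
      ball⁺ (suc k) hx le | inj₂ p =
        subst (_∈ ball gens (suc k)) (sym product)
          (step⁺ (ball⁺ k pred-InH (s≤s⁻¹ (≤-trans pred-< le))) generator∈)
        where open Predecessor p

      -- A predecessor has smaller `L`, and multiplying it by a generator adds at most one. So `L`
      -- falls by exactly one along a chain of predecessors and skips no value.
      shorter-elements : ∀ m {x} → InH x → L x ≡ m → ∀ {j} → j ≤ m → ∃ λ y → InH y × L y ≡ j
      shorter-elements m {x} hx e j≤m with m≤n⇒m<n∨m≡n j≤m
      shorter-elements m {x} hx e j≤m | inj₂ refl = x , hx , e
      shorter-elements (suc m) {x} hx e j≤m | inj₁ (s≤s j≤) with one-or-predecessor hx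
      ... | inj₁ refl = ⊥-elim (1+n≢0 (trans (sym e) L-one))
      ... | inj₂ p = shorter-elements m pred-InH
              (≤-antisym (s≤s⁻¹ (≤-trans pred-< (≤-reflexive e)))
                (s≤s⁻¹ (subst (_≤ suc (L pred)) (trans (cong L (sym product)) e)
                  (L-·-generator-≤ pred-InH generator∈)))) j≤
        where open Predecessor p

      -- The `L x + 1` values from 0 to `L x` are taken by different elements of `G`. This makes
      -- `length G` a sufficient radius in `gen` and sufficient fuel in `len`.
      L<∣G∣ : ∀ {x} → InH x → L x < length G
      L<∣G∣ {x} hx = subst (_≤ length G) (length-upTo (suc (L x)))
        (length-≤-by-relation (λ j y → L y ≡ j) (Uniq.upTo⁺ (suc (L x)))
          (λ j∈ → let y , hy , e = shorter-elements (L x) hx refl (s≤s⁻¹ (∈-upTo⁻ j∈)) in y , ∈G⁺ (element hy) , e)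
          λ { _ _ _ refl refl → refl })

      gen⁻ : ∀ {x} → x ∈ gen gens → InH x
      gen⁻ x∈ = proj₁ (ball⁻ (length G) x∈)

      gen⁺ : ∀ {x} → InH x → x ∈ gen gens
      gen⁺ hx = ball⁺ (length G) hx (<⇒≤ (L<∣G∣ hx))

      -- The invariant `k ≤ L x` records that the smaller balls have missed `x`; the other bound
      -- says that the remaining fuel reaches it.
      lenFrom≡L : ∀ fuel k {x} → InH x → k ≤ L x → L x ≤ k + fuel → lenFrom gens x (ball gens k) k fuel ≡ L x
      lenFrom≡L zero k {x} hx ge le = ≤-antisym ge (subst (L x ≤_) (+-identityʳ k) le)
      lenFrom≡L (suc fuel) k {x} hx ge le with x ∈ᵇ ball gens k in eq
      ... | true = ≤-antisym ge (proj₂ (ball⁻ k (∈ᵇ⁻ {x} (subst T (sym eq) tt))))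
      ... | false = lenFrom≡L fuel (suc k) hx
            (≰⇒> λ le′ → subst T eq (∈ᵇ⁺ {x} (ball⁺ k hx le′))) (subst (L x ≤_) (+-suc k fuel) le)

      len≡L : ∀ {x} → InH x → len gens x ≡ L x
      len≡L hx = lenFrom≡L (length G) 0 hx z≤n (<⇒≤ (L<∣G∣ hx))

    record Reduced (e : Elem) : Set where
      field
        reduced-col : ∀ {i} → i < n → Sg i → col e i ≡ 0
        reduced-act : Increasing (act e)

    open Reduced public

    -- Position by position the colour of `e` survives in `h · e`: on a positive block it is zero
    -- anyway, and elsewhere `h` adds nothing, so reduction modulo `r` cannot destroy it.
    Reduced⇒minimal : ∀ {e h} → InG e → InH h → Reduced e → L e ≤ L (h · e)
    Reduced⇒minimal {e} {h} ge hh re = +-mono-≤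
      (cost-≤-reindexed (perm (element hh)) λ i< → ≤-trans (bound i<) (≤-reflexive (sym (col-· h e i<))))
      (≤-trans (inv♯-increasing-minimal (reduced-act re) (perm (element hh)) (preserving hh))
        (≤-reflexive (inv♯-cong (λ i< → sym (act-· h e i<)))))
      where
      bound : ∀ {i} → i < n → col e (act h i) ≤ (col h i + col e (act h i)) % r
      bound {i} i< with Sg? i | to< (perm (element hh)) i<
      ... | yes p | hi< = ≤-trans (≤-reflexive (reduced-col re hi< (Sg-cong i< hi< (~-sym (preserving hh i<)) p))) z≤n
      ... | no ¬p | hi< = ≤-reflexive (trans (sym (%-identity (col< ge hi<)))
              (cong (λ z → (z + col e (act h i)) % r) (sym (col-zero hh i< ¬p))))

    -- Two kinds of test elements suffice: a power of one `t` that kills a colour of `e`, and an `s`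
    -- that removes a descent.
    minimal⇒Reduced : ∀ {e} → InG e → (∀ {h} → InH h → L e ≤ L (h · e)) → Reduced e
    minimal⇒Reduced {e} ge minimal = record { reduced-col = cols ; reduced-act = acts }
      where
      cols : ∀ {i} → i < n → Sg i → col e i ≡ 0
      cols {i} i< Sgi = n≤0⇒n≡0 (≮⇒≥ λ pos → <⇒≱ (shorter pos) (minimal (hh pos)))
        where
        c : ℕ → ℕ
        -- `h` is the power of `t (suc i)` that cancels the colour of `e` at `i`. For colour zero
        -- the exponent would be `r`, which is not a legal colour, hence the assumption `pos` below.
        c = upd i (r ∸ col e i) (λ _ → 0)
        h = mk c id
        c< : 0 < col e i → ∀ k → c k < r
        c< pos k with k ≟ i
        ... | yes _ = ∸-monoʳ-< {r} pos (<⇒≤ (col< ge i<))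
        ... | no _ = 0<r
        hh : 0 < col e i → InH h
        hh pos = record
          { element = mk-InG (λ {k} _ → c< pos k) id-perm
          ; preserving = λ {k} k< → subst (_~ k) (sym (act-mk c id k<)) ~-refl
          ; col-zero = λ {k} k< ¬Sg → trans (col-mk c id k<)
              (upd-there {i} {k} (r ∸ col e i) (λ _ → 0) λ { refl → ¬Sg Sgi }) }
        col-he : ∀ {k} → k < n → col (h · e) k ≡ (c k + col e k) % r
        col-he k< = trans (col-· h e k<) (cong₂ (λ a b → (a + col e b) % r) (col-mk c id k<) (act-mk c id k<))
        col-he-i : col (h · e) i ≡ 0
        col-he-i = trans (col-he i<) (trans (cong (λ z → (z + col e i) % r) (upd-here i (r ∸ col e i) (λ _ → 0)))
          (trans (cong (_% r) (m∸n+n≡m (<⇒≤ (col< ge i<)))) (n%n≡0 r)))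
        he≤ : ∀ {k} → k < n → col (h · e) k ≤ col e k
        he≤ {k} k< with k ≟ i
        ... | yes refl = subst (_≤ col e i) (sym col-he-i) z≤n
        ... | no ne = ≤-trans (≤-reflexive (trans (col-he k<)
                (cong (λ z → (z + col e k) % r) (upd-there (r ∸ col e i) (λ _ → 0) ne))))
                (m%n≤m _ r)
        shorter : 0 < col e i → L (h · e) < L e
        shorter pos = +-mono-<-≤ {x = cost (col (h · e))}
          (cost-decrement {col e} {col (h · e)} {i} he≤ i< (col< ge i<) (subst (_< col e i) (sym col-he-i) pos))
          (≤-reflexive (inv♯-cong λ k< → trans (act-· h e k<) (cong (act e) (act-mk c id k<))))
      acts : Increasing (act e)
      acts {a} a< a~ = ≤∧≢⇒< (≮⇒≥ λ desc → <⇒≱ (shorter desc) (minimal (s-InH a< a~)))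
        (<⇒≢ (n<1+n a) ∘ injective (perm ge) (<-trans (n<1+n a) a<) a<)
        where
        g = s (suc a)
        shorter : act e (suc a) < act e a → L (g · e) < L e
        shorter desc = +-mono-≤-< {x = cost (col (g · e))}
          (cost-≤-reindexed (sw-perm a<) λ {k} k< → ≤-reflexive (trans (col-· g e (sw-< a< k<))
            (trans (cong₂ (λ x y → (x + col e y) % r) (col-s (suc a) (sw a k))
              (trans (act-s a (sw-< a< k<)) (sw-invol a k)))
            (%-identity (col< ge k<)))))
          (≤-<-trans (≤-reflexive (inv♯-cong λ k< → trans (act-· g e k<) (cong (act e) (act-s a k<))))
            (inv♯-swap-positions {act e} a< desc))

-- Signed compositions: the block and sign of a position

total : List ℤ → ℕ
total μ = foldr _+_ 0 (map ∣_∣ μ)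

block : List ℤ → ℕ → ℕ
block [] i = 0
block (z ∷ μ) i with i <? ∣ z ∣
... | yes _ = 0
... | no _ = suc (block μ (i ∸ ∣ z ∣))

-- The sign test is a parameter: `isPos` describes μ, `isPos ∘ -_` describes -μ on the blocks of μ,
-- and the constant `false` describes the Young subgroup.
sign : (ℤ → Bool) → List ℤ → ℕ → Bool
sign b [] i = false
sign b (z ∷ μ) i with i <? ∣ z ∣
... | yes _ = b z
... | no _ = sign b μ (i ∸ ∣ z ∣)

block-first : ∀ z μ {i} → i < ∣ z ∣ → block (z ∷ μ) i ≡ 0
block-first z μ {i} i< with i <? ∣ z ∣
... | yes _ = refl
... | no ¬i< = ⊥-elim (¬i< i<)

block-rest : ∀ z μ i → block (z ∷ μ) (∣ z ∣ + i) ≡ suc (block μ i)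
block-rest z μ i with ∣ z ∣ + i <? ∣ z ∣
... | yes lt = ⊥-elim (m+n≮m ∣ z ∣ i lt)
... | no _ = cong (suc ∘ block μ) (m+n∸m≡n ∣ z ∣ i)

sign-first : ∀ b z μ {i} → i < ∣ z ∣ → sign b (z ∷ μ) i ≡ b z
sign-first b z μ {i} i< with i <? ∣ z ∣
... | yes _ = refl
... | no ¬i< = ⊥-elim (¬i< i<)

sign-rest : ∀ b z μ i → sign b (z ∷ μ) (∣ z ∣ + i) ≡ sign b μ i
sign-rest b z μ i with ∣ z ∣ + i <? ∣ z ∣
... | yes lt = ⊥-elim (m+n≮m ∣ z ∣ i lt)
... | no _ = cong (sign b μ) (m+n∸m≡n ∣ z ∣ i)

block-mono : ∀ μ {i j} → i ≤ j → block μ i ≤ block μ j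
block-mono [] _ = z≤n
block-mono (z ∷ μ) {i} {j} i≤j with i <? ∣ z ∣ | j <? ∣ z ∣
... | yes _ | _ = z≤n
... | no ¬i< | yes j< = ⊥-elim (¬i< (≤-<-trans i≤j j<))
... | no _ | no _ = s≤s (block-mono μ (∸-monoˡ-≤ ∣ z ∣ i≤j))

same-block⇒same-sign : ∀ b μ {i j} → block μ i ≡ block μ j → sign b μ i ≡ sign b μ j
same-block⇒same-sign b [] _ = refl
same-block⇒same-sign b (z ∷ μ) {i} {j} e with i <? ∣ z ∣ | j <? ∣ z ∣
... | yes _ | yes _ = refl
... | no _ | no _ = same-block⇒same-sign b μ (suc-injective e)

-- Negation flips `isPos` except at zero, and a block that contains an index has nonzero size.
isPos-neg : ∀ z {i} → i < ∣ z ∣ → isPos (- z) ≡ not (isPos z)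
isPos-neg (ℤ.+ zero) ()
isPos-neg (ℤ.+ suc _) _ = refl
isPos-neg ℤ.-[1+ _ ] _ = refl

sign-neg : ∀ μ {i} → i < total μ → sign (isPos ∘ -_) μ i ≡ not (sign isPos μ i)
sign-neg (z ∷ μ) {i} i< with i <? ∣ z ∣
... | yes i<z = isPos-neg z i<z
... | no ¬i<z = sign-neg μ (subst (i ∸ ∣ z ∣ <_) (m+n∸m≡n ∣ z ∣ (total μ)) (∸-monoˡ-< i< (≮⇒≥ ¬i<z)))

T-not⁻ : ∀ {b} → T (not b) → ¬ T b
T-not⁻ {false} _ ()

T-not⁺ : ∀ {b} → ¬ T b → T (not b)
T-not⁺ {true} f = f tt
T-not⁺ {false} _ = tt

-- `inv` is a search through `G` with `one` as fallback; as soon as some candidate passes the test,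
-- the result is a candidate that passes.
foldr-select : ∀ (p : Elem → Bool) z xs {y} → y ∈ xs → T (p y) →
  let w = foldr (λ y acc → if p y then y else acc) z xs in w ∈ xs × T (p w)
foldr-select p z (x ∷ xs) y∈ py with p x in eq
... | true = here refl , subst T (sym eq) tt
foldr-select p z (x ∷ xs) (here refl) py | false = ⊥-elim (subst T eq py)
foldr-select p z (x ∷ xs) (there y∈) py | false = let w∈ , pw = foldr-select p z xs y∈ py in there w∈ , pw

<-∸1⁻ : ∀ {k m} → k < m ∸ 1 → suc k < m
<-∸1⁻ {m = suc m} = s≤s

<-∸1⁺ : ∀ {k m} → suc k < m → k < m ∸ 1
<-∸1⁺ {m = suc m} = s≤s⁻¹

-- The standard subgroups as subgroups of shapes

module StandardSubgroups (r : ℕ) .{{_ : NonZero r}} (n : ℕ) where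
  open ReflectionSubgroups r n public

  -- The whole group for `true`, the symmetric group for `false`; thus `ℓ` and `coxLen` are both
  -- covered by `len≡L`.
  oneBlock : Bool → Shape
  oneBlock b = record
    { _~_ = λ _ _ → ⊤ ; ~-refl = tt ; ~-sym = λ _ → tt ; ~-trans = λ _ _ → tt ; _~?_ = λ _ _ → yes tt
    ; ~-convex = λ _ _ _ _ → tt ; Sg = λ _ → T b ; Sg? = λ _ → T? b ; Sg-cong = λ _ _ _ p → p }

  module Full = Subgroup (oneBlock true)
  module Sym = Subgroup (oneBlock false)

  Sgens-generate : Sym.GeneratedBy Sgens
  Sgens-generate = record
    { sound = λ π∈ → let k , k∈ , e = ∈-map⁻ (λ i → s (suc i)) π∈ in inj₁ (k , <-∸1⁻ (∈-upTo⁻ k∈) , tt , e)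
    ; s∈ = λ a< _ → ∈-map⁺ (λ i → s (suc i)) (∈-upTo⁺ (<-∸1⁺ a<))
    ; t∈ = λ _ () }

  Π-generates : Full.GeneratedBy Π
  Π-generates = record
    { sound = sound
    ; s∈ = λ a< _ → ∈-++⁺ʳ (map (λ i → t (suc i)) idx) (Sym.GeneratedBy.s∈ Sgens-generate a< tt)
    ; t∈ = λ j< _ → ∈-++⁺ˡ (∈-map⁺ (λ i → t (suc i)) (∈-upTo⁺ j<)) }
    where
    sound : ∀ {π} → π ∈ Π → (∃ λ a → suc a < n × ⊤ × π ≡ s (suc a)) ⊎ (∃ λ j → j < n × ⊤ × π ≡ t (suc j))
    sound π∈ with ∈-++⁻ (map (λ i → t (suc i)) idx) π∈
    ... | inj₁ p = let j , j∈ , e = ∈-map⁻ (λ i → t (suc i)) p in inj₂ (j , ∈-upTo⁻ j∈ , tt , e)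
    ... | inj₂ q = let k , k∈ , e = ∈-map⁻ (λ i → s (suc i)) q in inj₁ (k , <-∸1⁻ (∈-upTo⁻ k∈) , tt , e)

  Full-InH : ∀ {x} → InG x → Full.InH x
  Full-InH x∈ = record { element = x∈ ; preserving = λ _ → tt ; col-zero = λ _ ¬tt → ⊥-elim (¬tt tt) }

  ℓ≡L : ∀ {x} → InG x → ℓ x ≡ L x
  ℓ≡L x∈ = Full.len≡L Π-generates (Full-InH x∈)

  shape : (ℤ → Bool) → List ℤ → Shape
  shape b μ = record
    { _~_ = λ i j → block μ i ≡ block μ j ; ~-refl = refl ; ~-sym = sym ; ~-trans = trans
    ; _~?_ = λ i j → block μ i ≟ block μ j
    ; ~-convex = λ i≤k k≤j _ e → ≤-antisym (block-mono μ i≤k) (subst (block μ _ ≤_) (sym e) (block-mono μ k≤j))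
    ; Sg = λ i → T (sign b μ i) ; Sg? = λ i → T? (sign b μ i)
    ; Sg-cong = λ _ _ e → subst T (same-block⇒same-sign b μ e) }

  opposite : Shape → Shape
  opposite S = record
    { _~_ = _~_ ; ~-refl = ~-refl ; ~-sym = ~-sym ; ~-trans = ~-trans ; _~?_ = _~?_ ; ~-convex = ~-convex
    ; Sg = λ i → ¬ Sg i ; Sg? = λ i → ¬? (Sg? i)
    ; Sg-cong = λ i< j< e ¬p p → ¬p (Sg-cong j< i< (~-sym e) p) }
    where open Shape S

  -- A common form of `Πsc` for μ, `Πsc` for -μ and `Ygens`, so that membership in these lists is
  -- analysed only once.
  generators : (ℤ → Bool) → ℕ → List ℤ → List Elem
  generators b o [] = []
  generators b o (z ∷ μ) =
    map (λ k → s (o + suc k)) (upTo (∣ z ∣ ∸ 1))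
    ++ (if b z then map (λ k → t (o + suc k)) (upTo ∣ z ∣) else [])
    ++ generators b (o + ∣ z ∣) μ

  Πsc≡generators : ∀ o μ → Πsc o μ ≡ generators isPos o μ
  Πsc≡generators o [] = refl
  Πsc≡generators o (z ∷ μ) rewrite Πsc≡generators (o + ∣ z ∣) μ = refl

  Πsc-neg≡generators : ∀ o μ → Πsc o (neg μ) ≡ generators (isPos ∘ -_) o μ
  Πsc-neg≡generators o [] = refl
  Πsc-neg≡generators o (z ∷ μ) rewrite ∣-i∣≡∣i∣ z | Πsc-neg≡generators (o + ∣ z ∣) μ = refl

  Ygens≡generators : ∀ o μ → Ygens o (plus μ) ≡ generators (λ _ → false) o μ
  Ygens≡generators o [] = refl
  Ygens≡generators o (z ∷ μ) rewrite Ygens≡generators (o + ∣ z ∣) μ = refl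

  data GeneratorView (b : ℤ → Bool) (o : ℕ) (μ : List ℤ) : Elem → Set where
    is-s : ∀ {a} → suc a < total μ → block μ a ≡ block μ (suc a) → GeneratorView b o μ (s (o + suc a))
    is-t : ∀ {j} → j < total μ → T (sign b μ j) → GeneratorView b o μ (t (o + suc j))

  shift-index : ∀ o m k → o + m + suc k ≡ o + suc (m + k)
  shift-index o m k = trans (+-assoc o m (suc k)) (cong (o +_) (+-suc m k))

  GeneratorView-shift : ∀ b o z μ {π} → GeneratorView b (o + ∣ z ∣) μ π → GeneratorView b o (z ∷ μ) π
  GeneratorView-shift b o z μ (is-s {a} a< e) rewrite shift-index o ∣ z ∣ a = is-s
    (subst (_< ∣ z ∣ + total μ) (+-suc ∣ z ∣ a) (+-monoʳ-< ∣ z ∣ a<))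
    (trans (block-rest z μ a) (trans (cong suc e)
      (trans (sym (block-rest z μ (suc a))) (cong (block (z ∷ μ)) (+-suc ∣ z ∣ a)))))
  GeneratorView-shift b o z μ (is-t {j} j< p) rewrite shift-index o ∣ z ∣ j = is-t
    (+-monoʳ-< ∣ z ∣ j<) (subst T (sym (sign-rest b z μ j)) p)

  generators-sound : ∀ b o μ {π} → π ∈ generators b o μ → GeneratorView b o μ π
  generators-sound b o (z ∷ μ) π∈ with ∈-++⁻ (map (λ k → s (o + suc k)) (upTo (∣ z ∣ ∸ 1))) π∈
  ... | inj₁ p with ∈-map⁻ (λ k → s (o + suc k)) p
  ...   | k , k∈ , refl = is-s (m≤n⇒m≤n+o (total μ) k<)
            (trans (block-first z μ (<-trans (n<1+n k) k<)) (sym (block-first z μ k<)))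
    where
    k< : suc k < ∣ z ∣
    k< = <-∸1⁻ (∈-upTo⁻ k∈)
  generators-sound b o (z ∷ μ) π∈ | inj₂ q
    with ∈-++⁻ (if b z then map (λ k → t (o + suc k)) (upTo ∣ z ∣) else []) q
  ... | inj₂ q′ = GeneratorView-shift b o z μ (generators-sound b (o + ∣ z ∣) μ q′)
  ... | inj₁ p with b z in eq
  ...   | true with ∈-map⁻ (λ k → t (o + suc k)) p
  ...     | k , k∈ , refl = is-t (m≤n⇒m≤n+o (total μ) (∈-upTo⁻ k∈))
              (subst T (sym (trans (sign-first b z μ (∈-upTo⁻ k∈)) eq)) tt)

  splitAt : ∀ m i → i < m ⊎ (∃ λ k → i ≡ m + k)
  splitAt m i with i <? m
  ... | yes lt = inj₁ lt
  ... | no ge = inj₂ (i ∸ m , sym (m+[n∸m]≡n (≮⇒≥ ge)))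

  s∈generators : ∀ b o μ {a} → suc a < total μ → block μ a ≡ block μ (suc a) → s (o + suc a) ∈ generators b o μ
  s∈generators b o (z ∷ μ) {a} a< e with splitAt ∣ z ∣ (suc a) | splitAt ∣ z ∣ a
  ... | inj₁ a<z | _ = ∈-++⁺ˡ (∈-map⁺ (λ k → s (o + suc k)) (∈-upTo⁺ (<-∸1⁺ a<z)))
  -- Here `a` ends the first block and `suc a` begins the rest, so they cannot share a block.
  ... | inj₂ (k , p) | inj₁ a<z = ⊥-elim (0≢1+n
          (trans (sym (block-first z μ a<z)) (trans e (trans (cong (block (z ∷ μ)) p) (block-rest z μ k)))))
  ... | inj₂ _ | inj₂ (k , refl) = ∈-++⁺ʳ (map (λ k → s (o + suc k)) (upTo (∣ z ∣ ∸ 1)))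
          (∈-++⁺ʳ (if b z then map (λ k → t (o + suc k)) (upTo ∣ z ∣) else [])
            (subst (λ j → s j ∈ generators b (o + ∣ z ∣) μ) (shift-index o ∣ z ∣ k)
              (s∈generators b (o + ∣ z ∣) μ (+-cancelˡ-< ∣ z ∣ _ _ (subst (_< ∣ z ∣ + total μ) (sym (+-suc ∣ z ∣ k)) a<))
                (suc-injective (trans (sym (block-rest z μ k)) (trans e
                  (trans (cong (block (z ∷ μ)) (sym (+-suc ∣ z ∣ k))) (block-rest z μ (suc k)))))))))

  t∈generators : ∀ b o μ {j} → j < total μ → T (sign b μ j) → t (o + suc j) ∈ generators b o μ
  t∈generators b o (z ∷ μ) {j} j< p with splitAt ∣ z ∣ j
  ... | inj₁ j<z = ∈-++⁺ʳ (map (λ k → s (o + suc k)) (upTo (∣ z ∣ ∸ 1))) (∈-++⁺ˡ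
          (here-t (subst T (sign-first b z μ j<z) p)))
    where
    here-t : ∀ {β} → T β → t (o + suc j) ∈ (if β then map (λ k → t (o + suc k)) (upTo ∣ z ∣) else [])
    here-t {true} _ = ∈-map⁺ (λ k → t (o + suc k)) (∈-upTo⁺ j<z)
  ... | inj₂ (k , refl) = ∈-++⁺ʳ (map (λ k → s (o + suc k)) (upTo (∣ z ∣ ∸ 1)))
          (∈-++⁺ʳ (if b z then map (λ k → t (o + suc k)) (upTo ∣ z ∣) else [])
            (subst (λ j → t j ∈ generators b (o + ∣ z ∣) μ) (shift-index o ∣ z ∣ k)
              (t∈generators b (o + ∣ z ∣) μ (+-cancelˡ-< ∣ z ∣ _ _ j<) (subst T (sign-rest b z μ k) p))))

  -- Order and multiplicity are ignored: coset minimality only quantifies over the list, and the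
  -- lists whose elements are counted are filtered from `G`, which has no repetitions.
  Enumerates : Shape → List Elem → Set
  Enumerates S X = ∀ {x} → (x ∈ X → Subgroup.InH S x) × (Subgroup.InH S x → x ∈ X)

  gen-enumerates : ∀ {S gens} → Subgroup.GeneratedBy S gens → Enumerates S (gen gens)
  gen-enumerates {S} g = Subgroup.gen⁻ S g , Subgroup.gen⁺ S g

  module Compositions (μ : List ℤ) (total≡n : total μ ≡ n) where

    generators-generate : ∀ b → Subgroup.GeneratedBy (shape b μ) (generators b 0 μ)
    generators-generate b = record
      { sound = λ π∈ → view (generators-sound b 0 μ π∈)
      ; s∈ = λ a< → s∈generators b 0 μ (subst (_ <_) (sym total≡n) a<)
      ; t∈ = λ j< → t∈generators b 0 μ (subst (_ <_) (sym total≡n) j<) }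
      where
      view : ∀ {π} → GeneratorView b 0 μ π → (∃ λ a → suc a < n × block μ a ≡ block μ (suc a) × π ≡ s (suc a)) ⊎
                                   (∃ λ j → j < n × T (sign b μ j) × π ≡ t (suc j))
      view (is-s {a} a< e) = inj₁ (a , subst (suc a <_) total≡n a< , e , refl)
      view (is-t {j} j< p) = inj₂ (j , subst (j <_) total≡n j< , p , refl)

    Gμ-enumerates : Enumerates (shape isPos μ) (Gμ μ)
    Gμ-enumerates = gen-enumerates (subst (Subgroup.GeneratedBy (shape isPos μ)) (sym (Πsc≡generators 0 μ))
      (generators-generate isPos))

    Young-enumerates : Enumerates (shape (λ _ → false) μ) (Young (plus μ))
    Young-enumerates = gen-enumerates (subst (Subgroup.GeneratedBy (shape (λ _ → false) μ)) (sym (Ygens≡generators 0 μ))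
      (generators-generate (λ _ → false)))

    -- Negation keeps the sizes of the parts, hence the blocks, and by `sign-neg` it complements the
    -- sign at every position.
    Gneg-enumerates : Enumerates (opposite (shape isPos μ)) (Gμ (neg μ))
    Gneg-enumerates = gen-enumerates (subst (Subgroup.GeneratedBy (opposite (shape isPos μ))) (sym (Πsc-neg≡generators 0 μ))
      (record
        { sound = λ π∈ → map₂ (λ (j , j< , p , e) → j , j< , T-not⁻ (subst T (flip-sign j<) p) , e)
                           (Subgroup.GeneratedBy.sound g π∈)
        ; s∈ = Subgroup.GeneratedBy.s∈ g
        ; t∈ = λ j< ¬p → Subgroup.GeneratedBy.t∈ g j< (subst T (sym (flip-sign j<)) (T-not⁺ ¬p)) }))
      where
      g = generators-generate (isPos ∘ -_)
      flip-sign : ∀ {j} → j < n → sign (isPos ∘ -_) μ j ≡ not (sign isPos μ j)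
      flip-sign j< = sign-neg μ (subst (_ <_) (sym total≡n) j<)

-- Double coset representatives and intersections with conjugates

module Cosets (r : ℕ) .{{_ : NonZero r}} (n : ℕ) where
  open StandardSubgroups r n public

  -- The paper's μ ∩ dν.
  meet : (S₁ S₂ : Shape) {d : ℕ → ℕ} → IsPerm d → Blocks.Increasing S₁ d → Shape
  meet S₁ S₂ {d} p inc = record
    { _~_ = λ i j → i S₁.~ j × d i S₂.~ d j
    ; ~-refl = S₁.~-refl , S₂.~-refl
    ; ~-sym = λ (a , b) → S₁.~-sym a , S₂.~-sym b
    ; ~-trans = λ (a , b) (a′ , b′) → S₁.~-trans a a′ , S₂.~-trans b b′
    ; _~?_ = λ i j → (i S₁.~? j) ×-dec (d i S₂.~? d j)
    -- Because `d` increases on the blocks of `S₁`, `d k` lies between `d i` and `d j`, and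
    -- convexity for `S₂` applies to the images.
    ; ~-convex = λ i≤k k≤j j< (a , b) →
        let i~k = S₁.~-convex i≤k k≤j j< a ; k< = ≤-<-trans k≤j j< in
        i~k , S₂.~-convex (mono i≤k k< i~k) (mono k≤j j< (S₁.~-trans (S₁.~-sym i~k) a)) (to< p j<) b
    ; Sg = λ i → S₁.Sg i × S₂.Sg (d i)
    ; Sg? = λ i → S₁.Sg? i ×-dec S₂.Sg? (d i)
    ; Sg-cong = λ i< j< (a , b) (x , y) → S₁.Sg-cong i< j< a x , S₂.Sg-cong (to< p i<) (to< p j<) b y }
    where
    module S₁ = Shape S₁
    module S₂ = Shape S₂
    mono : ∀ {i j} → i ≤ j → j < n → i S₁.~ j → d i ≤ d j
    mono i≤j j< e with m≤n⇒m<n∨m≡n i≤j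
    ... | inj₁ i<j = <⇒≤ (Blocks.increasing-on-block S₁ inc i<j j< e)
    ... | inj₂ refl = ≤-refl

  Sn⁻ : ∀ {d} → d ∈ Sn → Sym.InH d
  Sn⁻ = Sym.gen⁻ Sgens-generate

  Sn⁺ : ∀ {d} → Sym.InH d → d ∈ Sn
  Sn⁺ = Sym.gen⁺ Sgens-generate

  Sn-col : ∀ {d} → Sym.InH d → ∀ {i} → i < n → col d i ≡ 0
  Sn-col hd i< = Sym.InH.col-zero hd i< id

  permutation : ∀ {f} → IsPerm f → Sym.InH (mk (λ _ → 0) f)
  permutation {f} p = record { element = mk-InG (λ _ → 0<r) p ; preserving = λ _ → tt
                             ; col-zero = λ i< _ → col-mk (λ _ → 0) f i< }

  -- An inverse is exhibited so that the search defining `inv` succeeds. Afterwards only the fact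
  -- that its result is a right inverse in `G` is used.
  inv-spec : ∀ {d} → InG d → InG (inv d) × d · inv d ≡ one
  inv-spec {d} gd = let y∈ , e = foldr-select (λ y → eqE (d · y) one) one G (∈G⁺ gy) (eqE⁺ dy≡one)
                    in ∈G⁻ y∈ , eqE⁻ e
    where
    p = perm gd
    c : ℕ → ℕ
    -- The outer reduction is for colour zero, where `r ∸ 0` is not a legal colour.
    c i = (r ∸ col d (from p i)) % r
    y = mk c (from p)
    gy : InG y
    gy = mk-InG (λ _ → m%n<n _ r) (inverse p)
    cancel : ∀ a → a < r → (a + (r ∸ a) % r) % r ≡ 0
    cancel a a< = begin
      (a + (r ∸ a) % r) % r     ≡⟨ cong (λ z → (z + (r ∸ a) % r) % r) (%-identity a<) ⟨
      (a % r + (r ∸ a) % r) % r ≡⟨ %-distribˡ-+ a (r ∸ a) r ⟨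
      (a + (r ∸ a)) % r         ≡⟨ cong (_% r) (m+[n∸m]≡n (<⇒≤ a<)) ⟩
      r % r                     ≡⟨ n%n≡0 r ⟩
      0                         ∎
      where open ≡-Reasoning
    dy≡one : d · y ≡ one
    dy≡one = elem-ext (·-InG gd gy) one-InG
      (λ {i} i< → trans (col-· d y i<) (trans (cong (λ z → (col d i + z) % r)
        (trans (col-mk c (from p) (to< p i<)) (cong (λ z → (r ∸ col d z) % r) (from-to p i<))))
        (trans (cancel (col d i) (col< gd i<)) (sym (col-one i)))))
      (λ {i} i< → trans (act-· d y i<) (trans (act-mk c (from p) (to< p i<)) (trans (from-to p i<) (sym (act-one i<)))))

  act-inv : ∀ {d} (gd : InG d) {i} → i < n → act (inv d) i ≡ from (perm gd) i
  act-inv {d} gd {i} i< = trans (cong (act (inv d)) (sym (to-from p i<)))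
    (trans (sym (act-· d (inv d) (from< p i<))) (trans (cong (λ x → act x (from p i)) (proj₂ (inv-spec gd)))
      (act-one (from< p i<))))
    where p = perm gd

  inv-InSym : ∀ {d} → Sym.InH d → Sym.InH (inv d)
  inv-InSym {d} hd = record { element = gd′ ; preserving = λ _ → tt ; col-zero = λ i< _ → zero-col i< }
    where
    gd = Sym.InH.element hd
    gd′ = proj₁ (inv-spec gd)
    p = perm gd
    zero-col : ∀ {i} → i < n → col (inv d) i ≡ 0
    zero-col {i} i< = begin
      col (inv d) i                          ≡⟨ %-identity (col< gd′ i<) ⟨
      (0 + col (inv d) i) % r                ≡⟨ cong₂ (λ a b → (a + col (inv d) b) % r)
                                                  (Sn-col hd (from< p i<)) (to-from p i<) ⟨
      (col d (from p i) + col (inv d) (act d (from p i))) % r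
                                             ≡⟨ col-· d (inv d) (from< p i<) ⟨
      col (d · inv d) (from p i)             ≡⟨ cong (λ x → col x (from p i)) (proj₂ (inv-spec gd)) ⟩
      col one (from p i)                     ≡⟨ col-one _ ⟩
      0                                      ∎
      where open ≡-Reasoning

  module _ {S₁ S₂ : Shape} {X₁ X₂ : List Elem} (enum₁ : Enumerates S₁ X₁) (enum₂ : Enumerates S₂ X₂)
           {d : Elem} (hd : Sym.InH d) (inc : Blocks.Increasing S₁ (act d)) where
    private
      gd = Sym.InH.element hd
      p = perm gd
      module S₁ = Subgroup S₁
      module S₂ = Subgroup S₂
      module σ = Subgroup (meet S₁ S₂ p inc)

      conj : Elem → Elem
      conj x = inv d · (x · d)

      module _ {x : Elem} (gx : InG x) where

        conj-InG : InG (conj x)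
        conj-InG = ·-InG (proj₁ (inv-spec gd)) (·-InG gx gd)

        act-conj : ∀ {j} → j < n → act (conj x) (act d j) ≡ act d (act x j)
        act-conj {j} j< = trans (act-· (inv d) (x · d) (to< p j<))
          (trans (cong (act (x · d)) (trans (act-inv gd (to< p j<)) (from-to p j<))) (act-· x d j<))

        col-conj : ∀ {j} → j < n → col (conj x) (act d j) ≡ col x j
        col-conj {j} j< = begin
          col (conj x) (act d j)                 ≡⟨ col-· (inv d) (x · d) (to< p j<) ⟩
          (col (inv d) (act d j) + col (x · d) (act (inv d) (act d j))) % r
            ≡⟨ cong₂ (λ a b → (a + col (x · d) b) % r) (Sn-col (inv-InSym hd) (to< p j<))
                 (trans (act-inv gd (to< p j<)) (from-to p j<)) ⟩
          col (x · d) j % r                      ≡⟨ cong (_% r) (col-· x d j<) ⟩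
          (col x j + col d (act x j)) % r % r    ≡⟨ m%n%n≡m%n _ r ⟩
          (col x j + col d (act x j)) % r        ≡⟨ cong (λ a → (col x j + a) % r) (Sn-col hd (to< (perm gx) j<)) ⟩
          (col x j + 0) % r                      ≡⟨ cong (_% r) (+-identityʳ (col x j)) ⟩
          col x j % r                            ≡⟨ %-identity (col< gx j<) ⟩
          col x j                                ∎
          where open ≡-Reasoning

    -- Since `d` carries no colour, the conjugate does at `act d j` what `x` does at `j`, colour
    -- included. Every index below `n` has the form `act d j`, which gives the converse inclusion.
    conjMeet-enumerates : Enumerates (meet S₁ S₂ p inc) (conjMeet X₁ d X₂)
    conjMeet-enumerates {x} = to , back
      where
      test : Elem → Bool
      test x = (x ∈ᵇ X₁) ∧ (conj x ∈ᵇ X₂)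
      to : x ∈ conjMeet X₁ d X₂ → σ.InH x
      to x∈ with ∈-filterᵇ⁻ test {xs = G} x∈
      ... | x∈G , both with T-∧⁻ {x ∈ᵇ X₁} both
      ... | in₁ , in₂ = record
        { element = gx
        ; preserving = λ {i} i< → S₁.preserving h₁ i< ,
            subst (S₂._~ act d i) (act-conj gx i<) (S₂.preserving h₂ (to< p i<))
        ; col-zero = col-zero }
        where
        gx = ∈G⁻ x∈G
        h₁ : S₁.InH x
        h₁ = proj₁ enum₁ (∈ᵇ⁻ {x} in₁)
        h₂ : S₂.InH (conj x)
        h₂ = proj₁ enum₂ (∈ᵇ⁻ {conj x} in₂)
        col-zero : ∀ {i} → i < n → ¬ (S₁.Sg i × S₂.Sg (act d i)) → col x i ≡ 0
        col-zero {i} i< ¬Sg with S₁.Sg? i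
        ... | no ¬Sg₁ = S₁.col-zero h₁ i< ¬Sg₁
        ... | yes Sg₁ = trans (sym (col-conj gx i<)) (S₂.col-zero h₂ (to< p i<) λ Sg₂ → ¬Sg (Sg₁ , Sg₂))
      back : σ.InH x → x ∈ conjMeet X₁ d X₂
      back hx = ∈-filterᵇ⁺ test (∈G⁺ gx) (T-∧⁺ (∈ᵇ⁺ {x} (proj₂ enum₁ h₁)) (∈ᵇ⁺ {conj x} (proj₂ enum₂ h₂)))
        where
        gx = σ.element hx
        h₁ : S₁.InH x
        h₁ = record { element = gx ; preserving = proj₁ ∘ σ.preserving hx
                    ; col-zero = λ i< ¬Sg → σ.col-zero hx i< (¬Sg ∘ proj₁) }
        pull : (P : ℕ → Set) → (∀ {j} → j < n → P (act d j)) → ∀ {i} → i < n → P i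
        pull P h i< = subst P (to-from p i<) (h (from< p i<))
        h₂ : S₂.InH (conj x)
        h₂ = record
          { element = conj-InG gx
          ; preserving = pull (λ i → act (conj x) i S₂.~ i)
              λ {j} j< → subst (S₂._~ act d j) (sym (act-conj gx j<)) (proj₂ (σ.preserving hx j<))
          ; col-zero = pull (λ i → ¬ S₂.Sg i → col (conj x) i ≡ 0)
              λ j< ¬Sg → trans (col-conj gx j<) (σ.col-zero hx j< (¬Sg ∘ proj₂)) }

  inℰ⁻ : ∀ {S X e} → Enumerates S X → T (inℰ X e) → InG e × Subgroup.Reduced S e
  inℰ⁻ {S} {X} {e} enum h with T-∧⁻ {inG e} h
  ... | e∈ , minimal = ge , Subgroup.minimal⇒Reduced S ge λ {g} hg →
      subst₂ _≤_ (ℓ≡L ge) (ℓ≡L (·-InG (Subgroup.element hg) ge))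
        (≤ᵇ⇒≤ (ℓ e) (ℓ (g · e)) (T-all⁻ (λ g → ℓ e ≤ᵇ ℓ (g · e)) X minimal (proj₂ enum hg)))
    where
    ge = ∈G⁻ (∈ᵇ⁻ {e} e∈)

  inℰ⁺ : ∀ {S X e} → Enumerates S X → InG e → Subgroup.Reduced S e → T (inℰ X e)
  inℰ⁺ {S} {X} {e} enum ge re = T-∧⁺ (∈ᵇ⁺ {e} (∈G⁺ ge)) (T-all⁺ (λ g → ℓ e ≤ᵇ ℓ (g · e)) X λ g∈ →
    let hg = proj₁ enum g∈ in ≤⇒≤ᵇ (subst₂ _≤_ (sym (ℓ≡L ge)) (sym (ℓ≡L (·-InG (Subgroup.element hg) ge)))
      (Subgroup.Reduced⇒minimal S ge hg re)))

  record DoubleCosetRep (S₁ S₂ : Shape) (d : Elem) : Set where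
    field
      inSn               : Sym.InH d
      increasing         : Blocks.Increasing S₁ (act d)
      inverse-increasing : Blocks.Increasing S₂ (from (perm (Sym.element inSn)))

    act-perm : IsPerm (act d)
    act-perm = perm (Sym.element inSn)

    stabilizer : Shape
    stabilizer = meet S₁ S₂ act-perm increasing

    -- Not the opposite of `stabilizer`: a position counts here only if it is negative for `S₁` and
    -- its image is negative for `S₂`. These are the positions of free colour. `opposite` keeps the
    -- blocks, so `increasing` serves again.
    opposite-stabilizer : Shape
    opposite-stabilizer = meet (opposite S₁) (opposite S₂) act-perm increasing

  module DoubleCosets {μ ν : List ℤ} (totalμ : total μ ≡ n) (totalν : total ν ≡ n) where

    private
      sym-InH : ∀ {μ} → total μ ≡ n → ∀ {v} → v ∈ Young (plus μ) → Sym.InH v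
      sym-InH {μ} tot v∈ = record { element = Subgroup.element hv ; preserving = λ _ → tt
                              ; col-zero = λ i< _ → Subgroup.col-zero hv i< (no-sign μ) }
        where
        hv = proj₁ (Compositions.Young-enumerates μ tot) v∈
        no-sign : ∀ μ {i} → ¬ T (sign (λ _ → false) μ i)
        no-sign (z ∷ μ) {i} with i <? ∣ z ∣
        ... | yes _ = λ ()
        ... | no _ = no-sign μ

      coxLen≡L : ∀ {d} → Sym.InH d → coxLen d ≡ L d
      coxLen≡L = Sym.len≡L Sgens-generate

      Increasing : List ℤ → (ℕ → ℕ) → Set
      Increasing μ = Blocks.Increasing (shape isPos μ)

      -- On the symmetric group the Coxeter length is `L`, and a Young subgroup is the case without
      -- positive blocks, where being reduced amounts to being increasing. The blocks do not depend
      -- on the sign test, so the result can be read for `isPos`.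
      inD⁻ : ∀ {μ} → total μ ≡ n → ∀ {d} → Sym.InH d → T (inD (plus μ) d) → Increasing μ (act d)
      inD⁻ {μ} tot {d} hd h = Subgroup.reduced-act (Subgroup.minimal⇒Reduced (shape (λ _ → false) μ) (Sym.element hd)
        λ {v} hv → let v∈ = proj₂ (Compositions.Young-enumerates μ tot) hv ; hv′ = sym-InH {μ} tot v∈ in
          subst₂ _≤_ (coxLen≡L hd) (coxLen≡L (Sym.·-InH hv′ hd))
            (≤ᵇ⇒≤ _ _ (T-all⁻ (λ v → coxLen d ≤ᵇ coxLen (v · d)) (Young (plus μ)) h v∈)))

      inD⁺ : ∀ {μ} → total μ ≡ n → ∀ {d} → Sym.InH d → Increasing μ (act d) → T (inD (plus μ) d)
      inD⁺ {μ} tot {d} hd inc = T-all⁺ (λ v → coxLen d ≤ᵇ coxLen (v · d)) (Young (plus μ)) λ v∈ →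
        let hv = proj₁ (Compositions.Young-enumerates μ tot) v∈ ; hv′ = sym-InH {μ} tot v∈ in
        ≤⇒≤ᵇ (subst₂ _≤_ (sym (coxLen≡L hd)) (sym (coxLen≡L (Sym.·-InH hv′ hd)))
          (Subgroup.Reduced⇒minimal (shape (λ _ → false) μ) (Sym.element hd) hv
            (record { reduced-col = λ i< _ → Sn-col hd i< ; reduced-act = inc })))

    InD : Elem → Set
    InD = DoubleCosetRep (shape isPos μ) (shape isPos ν)

    D⁻ : ∀ {d} → d ∈ D (plus μ) (plus ν) → InD d
    D⁻ {d} d∈ with ∈-filterᵇ⁻ (λ w → inD (plus μ) w ∧ inD (plus ν) (inv w)) {xs = Sn} d∈
    ... | d∈Sn , both with T-∧⁻ {inD (plus μ) d} both
    ... | h₁ , h₂ = record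
      { inSn = hd ; increasing = inD⁻ {μ} totalμ hd h₁
      ; inverse-increasing = Blocks.Increasing-cong (shape isPos ν) (act-inv (Sym.element hd)) (inD⁻ {ν} totalν (inv-InSym hd) h₂) }
      where hd = Sn⁻ d∈Sn

    D⁺ : ∀ {d} → InD d → d ∈ D (plus μ) (plus ν)
    D⁺ {d} dd = ∈-filterᵇ⁺ (λ w → inD (plus μ) w ∧ inD (plus ν) (inv w)) (Sn⁺ inSn)
      (T-∧⁺ (inD⁺ {μ} totalμ inSn increasing)
        (inD⁺ {ν} totalν (inv-InSym inSn) (Blocks.Increasing-cong (shape isPos ν) (sym ∘ act-inv (Sym.element inSn)) inverse-increasing)))
      where open DoubleCosetRep dd

  ball-Unique : ∀ gens k → Unique (ball gens k)
  ball-Unique gens zero = [] ∷ []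
  ball-Unique gens (suc k) = deduplicateᵇ-Unique _

  D-Unique : ∀ λ′ ν′ → Unique (D λ′ ν′)
  D-Unique λ′ ν′ = Uniq.filter⁺ (λ w → T? (inD λ′ w ∧ inD ν′ (inv w))) (ball-Unique Sgens (length G))

pick : ∀ {P : Set} → Dec P → ℕ → ℕ → ℕ
pick (yes _) a b = a
pick (no _) a b = b

pick-yes : ∀ {P} (P? : Dec P) {a b} → P → pick P? a b ≡ a
pick-yes (yes _) _ = refl
pick-yes (no ¬p) p = ⊥-elim (¬p p)

pick-no : ∀ {P} (P? : Dec P) {a b} → ¬ P → pick P? a b ≡ b
pick-no (yes p) ¬p = ⊥-elim (¬p p)
pick-no (no _) _ = refl

pick-< : ∀ {P} (P? : Dec P) {a b m} → a < m → b < m → pick P? a b < m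
pick-< (yes _) a< _ = a<
pick-< (no _) _ b< = b<

-- Factorizations of `x` and coloured double coset representatives

module Factorizations (r : ℕ) .{{_ : NonZero r}} (n : ℕ) where
  open Cosets r n public

  -- `m` and `k` are opposite modulo `r`; this solves `y · z ≡ x` for the colours of `z`.
  %-cancel : ∀ {m k} e → m + k ≡ r → (m + (k + e) % r) % r ≡ e % r
  %-cancel {m} {k} e m+k≡r = begin
    (m + (k + e) % r) % r             ≡⟨ %-distribˡ-+ m ((k + e) % r) r ⟩
    (m % r + (k + e) % r % r) % r     ≡⟨ cong (λ z → (m % r + z) % r) (m%n%n≡m%n (k + e) r) ⟩
    (m % r + (k + e) % r) % r         ≡⟨ %-distribˡ-+ m (k + e) r ⟨
    (m + (k + e)) % r                 ≡⟨ cong (_% r) (+-assoc m k e) ⟨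
    (m + k + e) % r                   ≡⟨ cong (λ z → (z + e) % r) m+k≡r ⟩
    (r + e) % r                       ≡⟨ cong (_% r) (+-comm r e) ⟩
    (e + r) % r                       ≡⟨ [m+n]%n≡m%n e r ⟩
    e % r                             ∎
    where open ≡-Reasoning

  ·-cancelˡ : ∀ {y z z′} → InG y → InG z → InG z′ → y · z ≡ y · z′ → z ≡ z′
  ·-cancelˡ {y} {z} {z′} gy gz gz′ e = elem-ext gz gz′ (along cols) (along acts)
    where
    p = perm gy
    along : ∀ {f g : ℕ → ℕ} → (∀ {i} → i < n → f (act y i) ≡ g (act y i)) → ∀ {i} → i < n → f i ≡ g i
    along {f} {g} h i< = subst (λ j → f j ≡ g j) (to-from p i<) (h (from< p i<))
    acts : ∀ {i} → i < n → act z (act y i) ≡ act z′ (act y i)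
    acts {i} i< = trans (sym (act-· y z i<)) (trans (cong (λ x → act x i) e) (act-· y z′ i<))
    recover : ∀ {z} → InG z → ∀ {i} → i < n → col z (act y i) ≡ (r ∸ col y i + col (y · z) i) % r
    recover {z} gz {i} i< = sym (trans (cong (λ a → (r ∸ col y i + a) % r) (col-· y z i<))
      (trans (%-cancel (col z (act y i)) (m∸n+n≡m (<⇒≤ (col< gy i<)))) (%-identity (col< gz (to< p i<)))))
    cols : ∀ {i} → i < n → col z (act y i) ≡ col z′ (act y i)
    cols {i} i< = trans (recover gz i<)
      (trans (cong (λ x → (r ∸ col y i + col x i) % r) e) (sym (recover gz′ i<)))

  module _ (S₁ S₂ : Shape) (x : Elem) where
    private
      module S₁ = Subgroup S₁
      module S₂ = Subgroup S₂

    record Factorization (yz : Elem × Elem) : Set where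
      field
        y-InG     : InG (proj₁ yz)
        z-InG     : InG (proj₂ yz)
        product   : proj₁ yz · proj₂ yz ≡ x
        y-reduced : S₁.Reduced (proj₁ yz)
        z-reduced : S₂.Reduced (proj₂ yz)

    -- One unit of the coefficient of `x` on the right-hand side: a summand `d` in whose `E` the
    -- element `x` occurs, with one of the elements of `T` counted by the factor of that summand.
    record ColouredRep (dτ : Elem × Elem) : Set where
      field
        rep : DoubleCosetRep S₁ S₂ (proj₁ dτ)
      open DoubleCosetRep rep public
      field
        colouring   : Subgroup.InH opposite-stabilizer (proj₂ dτ)
        act-trivial : proj₂ (proj₂ dτ) ≡ idx
        x-InG       : InG x
        x-reduced   : Subgroup.Reduced stabilizer x

    -- Just enough data for either pair to determine the other among admissible ones: the blocks of
    -- the values, and the colours that `x` leaves open.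
    Match : Elem × Elem → Elem × Elem → Set
    Match (y , z) (d , τ) =
      (∀ {i} → i < n → act d i S₂.~ act y i) ×
      (∀ {i} → i < n → ¬ S₁.Sg i → ¬ S₂.Sg (act d i) → col τ i ≡ col y i)

    module _ {y z : Elem} (F : Factorization (y , z)) where
      open Factorization F

      product-act : ∀ {i} → i < n → act x i ≡ act z (act y i)
      product-act {i} i< = trans (cong (λ x → act x i) (sym product)) (act-· y z i<)

      product-col : ∀ {i} → i < n → col x i ≡ (col y i + col z (act y i)) % r
      product-col {i} i< = trans (cong (λ x → col x i) (sym product)) (col-· y z i<)

      -- `act z` is `act x` after the inverse of `act y`, so reducedness of `z` says that `y` sorts
      -- by `x` within each block of values. This is what `resort` produces and `resort-unique` pins
      -- down.
      z-increasing : S₂.Increasing (act x ∘ from (perm y-InG))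
      z-increasing = S₂.Increasing-cong (λ {i} i< → sym (trans (product-act (from< (perm y-InG) i<))
        (cong (act z) (to-from (perm y-InG) i<)))) (S₂.reduced-act z-reduced)

      product-col-left : ∀ {i} → i < n → S₂.Sg (act y i) → col x i ≡ col y i
      product-col-left {i} i< Sg = trans (product-col i<)
        (trans (cong (λ a → (col y i + a) % r) (S₂.reduced-col z-reduced (to< (perm y-InG) i<) Sg))
          (trans (cong (_% r) (+-identityʳ (col y i))) (%-identity (col< y-InG i<))))

      -- d is the permutation part of y with its values rearranged inside the blocks of S₂.
      factorization⇒coloured-rep : ∃ λ dτ → ColouredRep dτ × Match (y , z) dτ
      factorization⇒coloured-rep with S₂.resort (perm y-InG) id-perm
      ... | f , p , same , inc = (d , τ) , record
          { rep = rep
          ; colouring = record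
            { element = mk-InG (λ {i} i< → pick-< (Sg? i) (col< y-InG i<) 0<r) id-perm
            ; preserving = λ {i} i< → subst (_~ i) (sym (act-mk c id i<)) (~-refl {i})
            ; col-zero = λ {i} i< ¬Sg → trans (col-mk c id i<) (pick-no (Sg? i) ¬Sg) }
          ; act-trivial = at-ext n (length-map-upTo id n) (length-upTo n)
              (λ i< → trans (act-mk c id i<) (sym (at-upTo n i<)))
          ; x-InG = subst InG product (·-InG y-InG z-InG)
          ; x-reduced = record { reduced-col = λ i< (Sg₁ , Sg₂) → trans
                                   (product-col-left i< (S₂.Sg-cong (to< act-perm i<) (to< (perm y-InG) i<) (d~y i<) Sg₂))
                                   (S₁.reduced-col y-reduced i< Sg₁)
                               ; reduced-act = x-increasing } }
          , d~y , λ {i} i< ¬Sg₁ ¬Sg₂ → trans (col-mk c id i<) (pick-yes (Sg? i) (¬Sg₁ , ¬Sg₂))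
        where
        d : Elem
        d = mk (λ _ → 0) f
        f≗d : ∀ {i} → i < n → f i ≡ act d i
        f≗d i< = sym (act-mk (λ _ → 0) f i<)
        d~y : ∀ {i} → i < n → act d i S₂.~ act y i
        d~y {i} i< = subst (S₂._~ act y i) (f≗d i<) (same i<)
        rep : DoubleCosetRep S₁ S₂ d
        rep = record
          { inSn = permutation p
          -- With `g = id`, neighbours sent to one block of values are in order automatically, so
          -- `f` inherits monotonicity from `y`.
          ; increasing = S₁.Increasing-cong f≗d (transfer-increasing S₁ S₂ {g = id} (perm y-InG) p same
              (S₁.reduced-act y-reduced) inc (λ _ _ _ → n<1+n _))
          ; inverse-increasing = inc }
        open DoubleCosetRep rep
        open Shape opposite-stabilizer
        c : ℕ → ℕ
        c i = pick (Sg? i) (col y i) 0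
        τ : Elem
        τ = mk c id
        x-increasing : Blocks.Increasing stabilizer (act x)
        -- The values of `y` at `i` and `suc i` share a block of `S₂` because those of `d` do; `y`
        -- puts them in order and `z` keeps the order.
        x-increasing {i} i< (i~ , di~) = subst₂ _<_ (sym (product-act i<′)) (sym (product-act i<))
          (S₂.increasing-on-block (S₂.reduced-act z-reduced) (S₁.reduced-act y-reduced i< i~) (to< (perm y-InG) i<)
            (S₂.~-trans (S₂.~-sym (d~y i<′)) (S₂.~-trans di~ (d~y i<))))
          where
          i<′ : i < n
          i<′ = <-trans (n<1+n i) i<

    module _ {d τ : Elem} (C : ColouredRep (d , τ)) where
      open ColouredRep C

      -- The values of `d` are rearranged inside the blocks of `S₂` so as to sort by `x`. That the
      -- result still increases on the blocks of `S₁` uses that `x` is reduced for the stabilizer.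
      coloured-rep⇒factorization : ∃ λ yz → Factorization yz × Match yz (d , τ)
      coloured-rep⇒factorization with S₂.resort act-perm (perm x-InG)
      ... | f , p , same , inc = (y , z) , record
          { y-InG = gy
          ; z-InG = gz
          ; product = elem-ext (·-InG gy gz) x-InG
              (λ {i} i< → begin
                col (y · z) i                            ≡⟨ col-· y z i< ⟩
                (col y i + col z (act y i)) % r          ≡⟨ cong₂ (λ a b → (a + col z b) % r) (col-y i<) (act-y i<) ⟩
                (c i + col z (f i)) % r                  ≡⟨ cong (λ b → (c i + b) % r) (col-z i<) ⟩
                (c i + (r ∸ c i + col x i) % r) % r      ≡⟨ %-cancel (col x i) (m+[n∸m]≡n (<⇒≤ (c< i<))) ⟩
                col x i % r                              ≡⟨ %-identity (col< x-InG i<) ⟩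
                col x i                                  ∎)
              (λ {i} i< → trans (act-· y z i<) (trans (cong (act z) (act-y i<)) (trans (act-mk e v (to< p i<))
                (cong (act x) (from-to p i<)))))
          ; y-reduced = record
            { reduced-col = λ {i} i< Sg₁ → trans (col-y i<) (pick-yes (S₁.Sg? i) Sg₁)
            ; reduced-act = S₁.Increasing-cong (λ i< → sym (act-y i<))
                (transfer-increasing S₁ S₂ act-perm p same increasing inc
                  λ i< i~ di~ → Subgroup.reduced-act x-reduced i< (i~ , di~)) }
          ; z-reduced = record
            { reduced-col = λ {j} j< Sg₂ → subst (λ j → S₂.Sg j → col z j ≡ 0) (to-from p j<)
                (z-zero (from< p j<)) Sg₂
            ; reduced-act = S₂.Increasing-cong (λ j< → sym (act-mk e v j<)) inc } }
          , (λ {i} i< → subst (act d i S₂.~_) (sym (act-y i<)) (S₂.~-sym (same i<)))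
          , λ {i} i< ¬Sg₁ ¬Sg₂ → sym (trans (col-y i<) (trans (pick-no (S₁.Sg? i) ¬Sg₁) (pick-no (S₂.Sg? (act d i)) ¬Sg₂)))
        where
        open ≡-Reasoning
        c e v : ℕ → ℕ
        c i = pick (S₁.Sg? i) 0 (pick (S₂.Sg? (act d i)) (col x i) (col τ i))
        -- The colour of `z` is forced by the product: at `j = f i` it is the colour of `x` at `i`
        -- minus `c i`, modulo `r`.
        e j = (r ∸ c (from p j) + col x (from p j)) % r
        v = act x ∘ from p
        y z : Elem
        y = mk c f
        z = mk e v
        c< : ∀ {i} → i < n → c i < r
        c< {i} i< = pick-< (S₁.Sg? i) 0<r (pick-< (S₂.Sg? (act d i)) (col< x-InG i<)
          (col< (Subgroup.element colouring) i<))
        gy : InG y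
        gy = mk-InG c< p
        gz : InG z
        gz = mk-InG (λ _ → m%n<n _ r) (perm x-InG ∘ₚ inverse p)
        col-y : ∀ {i} → i < n → col y i ≡ c i
        col-y = col-mk c f
        act-y : ∀ {i} → i < n → act y i ≡ f i
        act-y = act-mk c f
        col-z : ∀ {i} → i < n → col z (f i) ≡ (r ∸ c i + col x i) % r
        col-z i< = trans (col-mk e v (to< p i<)) (cong (λ k → (r ∸ c k + col x k) % r) (from-to p i<))
        z-zero : ∀ {i} → i < n → S₂.Sg (f i) → col z (f i) ≡ 0
        z-zero {i} i< Sg = trans (col-z i<) (trans (cong (λ a → (r ∸ a + col x i) % r) (c≡x (S₁.Sg? i)))
          (trans (cong (_% r) (m∸n+n≡m (<⇒≤ (col< x-InG i<)))) (n%n≡0 r)))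
          where
          Sg₂ : S₂.Sg (act d i)
          Sg₂ = S₂.Sg-cong (to< p i<) (to< act-perm i<) (same i<) Sg
          c≡x : Dec (S₁.Sg i) → c i ≡ col x i
          -- Two demands meet here: reducedness of `y` asks for 0, that of `z` for the colour of
          -- `x`. They agree because `x` is reduced for the stabilizer.
          c≡x (yes Sg₁) = trans (pick-yes (S₁.Sg? i) Sg₁) (sym (Subgroup.reduced-col x-reduced i< (Sg₁ , Sg₂)))
          c≡x (no ¬Sg₁) = trans (pick-no (S₁.Sg? i) ¬Sg₁) (pick-yes (S₂.Sg? (act d i)) Sg₂)

      -- Both left factors sort the same blocks of values by `x`, so `resort-unique` identifies
      -- their permutations. Each colour is zero, that of `x`, or stored in `τ`, and the right
      -- factor follows by cancellation.
      Match-injectiveˡ : ∀ {yz yz′} → Factorization yz → Factorization yz′ → Match yz (d , τ) → Match yz′ (d , τ) → yz ≡ yz′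
      Match-injectiveˡ {y , z} {y′ , z′} F F′ (same , cols) (same′ , cols′) =
        combine y≡y′
        where
        module F = Factorization F
        module F′ = Factorization F′
        acts : ∀ {i} → i < n → act y i ≡ act y′ i
        acts = S₂.resort-unique {g = act x} (perm F′.y-InG) (perm F.y-InG)
          (λ i< → S₂.~-trans (S₂.~-sym (same i<)) (same′ i<)) (z-increasing F′) (z-increasing F)
        columns : ∀ {i} → i < n → col y i ≡ col y′ i
        columns {i} i< with S₁.Sg? i | S₂.Sg? (act d i)
        ... | yes Sg₁ | _ = trans (S₁.reduced-col F.y-reduced i< Sg₁) (sym (S₁.reduced-col F′.y-reduced i< Sg₁))
        ... | no _ | yes Sg₂ = trans (sym (product-col-left F i< (S₂.Sg-cong (to< act-perm i<) (to< (perm F.y-InG) i<) (same i<) Sg₂)))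
                (product-col-left F′ i< (S₂.Sg-cong (to< act-perm i<) (to< (perm F′.y-InG) i<) (same′ i<) Sg₂))
        ... | no ¬Sg₁ | no ¬Sg₂ = trans (sym (cols i< ¬Sg₁ ¬Sg₂)) (cols′ i< ¬Sg₁ ¬Sg₂)
        y≡y′ : y ≡ y′
        y≡y′ = elem-ext F.y-InG F′.y-InG columns acts
        combine : y ≡ y′ → (y , z) ≡ (y′ , z′)
        combine refl = cong (y ,_) (·-cancelˡ F.y-InG F.z-InG F′.z-InG (trans F.product (sym F′.product)))

    -- The blocks of the values of `y` leave one permutation whose inverse increases on blocks. Once
    -- the two permutations agree, both colourings vanish outside the same positions and copy `y` on
    -- them.
    Match-injectiveʳ : ∀ {yz dτ dτ′} → ColouredRep dτ → ColouredRep dτ′ → Match yz dτ → Match yz dτ′ → dτ ≡ dτ′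
    Match-injectiveʳ {y , z} {d , τ} {d′ , τ′} C C′ (same , cols) (same′ , cols′) = cong₂ _,_
      (elem-ext (Sym.element C.inSn) (Sym.element C′.inSn)
        (λ i< → trans (Sn-col C.inSn i<) (sym (Sn-col C′.inSn i<))) acts)
      (elem-ext (Subgroup.element C.colouring) (Subgroup.element C′.colouring) columns
        λ {i} _ → cong (λ w → at w i) (trans C.act-trivial (sym C′.act-trivial)))
      where
      module C = ColouredRep C
      module C′ = ColouredRep C′
      acts : ∀ {i} → i < n → act d i ≡ act d′ i
      acts = S₂.resort-unique {g = id} C′.act-perm C.act-perm
        (λ i< → S₂.~-trans (same i<) (S₂.~-sym (same′ i<))) C′.inverse-increasing C.inverse-increasing
      columns : ∀ {i} → i < n → col τ i ≡ col τ′ i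
      columns {i} i< with Shape.Sg? C.opposite-stabilizer i
      ... | yes (¬Sg₁ , ¬Sg₂) = trans (cols i< ¬Sg₁ ¬Sg₂) (sym (cols′ i< ¬Sg₁ (subst (λ j → ¬ S₂.Sg j) (acts i<) ¬Sg₂)))
      ... | no ¬Sg = trans (Subgroup.col-zero C.colouring i< ¬Sg) (sym (Subgroup.col-zero C′.colouring i<
              λ (¬Sg₁ , ¬Sg₂) → ¬Sg (¬Sg₁ , subst (λ j → ¬ S₂.Sg j) (sym (acts i<)) ¬Sg₂)))

-- Sums of indicators in the coefficient ring

module IndicatorSums {c ℓ} (R : CommutativeRing c ℓ) where
  private module R = CommutativeRing R
  open R using (Carrier; _≈_; 0#; 1#) renaming (_+_ to _+R_; _*_ to _*R_)
  open RingSum R renaming (Σ to ΣR)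

  indicator : Bool → Carrier
  indicator b = if b then 1# else 0#

  fromℕ-+ : ∀ j k → fromℕ (j + k) ≈ fromℕ j +R fromℕ k
  fromℕ-+ zero k = R.sym (R.+-identityˡ (fromℕ k))
  fromℕ-+ (suc j) k = R.trans (R.+-congˡ (fromℕ-+ j k)) (R.sym (R.+-assoc 1# (fromℕ j) (fromℕ k)))

  sum-indicator : ∀ {a} {A : Set a} (p : A → Bool) (f : A → Carrier) → (∀ a → f a ≈ indicator (p a)) →
    ∀ xs → ΣR (map f xs) ≈ fromℕ (length (filterᵇ p xs))
  sum-indicator p f e [] = R.refl
  sum-indicator p f e (x ∷ xs) with p x | e x
  ... | true | fx≈ = R.+-cong fx≈ (sum-indicator p f e xs)
  ... | false | fx≈ = R.trans (R.+-cong fx≈ (sum-indicator p f e xs)) (R.+-identityˡ _)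

  sum-concatMap : ∀ {a b} {A : Set a} {B : Set b} (g : A → List B) (f : A → Carrier) →
    (∀ a → f a ≈ fromℕ (length (g a))) → ∀ xs → ΣR (map f xs) ≈ fromℕ (length (concatMap g xs))
  sum-concatMap g f e [] = R.refl
  sum-concatMap g f e (x ∷ xs) rewrite length-++ (g x) {concatMap g xs} =
    R.trans (R.+-cong (e x) (sum-concatMap g f e xs)) (R.sym (fromℕ-+ (length (g x)) _))

  concatMap-cartesianProduct : ∀ {a b c} {A : Set a} {B : Set b} {C : Set c} (f : A → B → C) xs ys →
    concatMap (λ x → map (f x) ys) xs ≡ map (λ (x , y) → f x y) (cartesianProduct xs ys)
  concatMap-cartesianProduct f [] ys = refl
  concatMap-cartesianProduct f (x ∷ xs) ys = trans
    (cong₂ _++_ (map-∘ ys) (concatMap-cartesianProduct f xs ys))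
    (sym (map-++ (λ (x , y) → f x y) (map (x ,_) ys) (cartesianProduct xs ys)))

  indicator-∧ : ∀ b₁ b₂ b₃ → (if b₁ then indicator b₂ *R indicator b₃ else 0#) ≈ indicator (b₁ ∧ (b₂ ∧ b₃))
  indicator-∧ true true b₃ = R.*-identityˡ (indicator b₃)
  indicator-∧ true false b₃ = R.zeroˡ (indicator b₃)
  indicator-∧ false b₂ b₃ = R.refl

-- Comparison of the coefficients of `x`

module Multiplication {c ℓ} (R : CommutativeRing c ℓ) (r : ℕ) .{{_ : NonZero r}} (n : ℕ) where
  open Factorizations r n
  private module R = CommutativeRing R
  open R using (Carrier; _≈_; 0#) renaming (_*_ to _*R_)
  open RingSum R renaming (Σ to ΣR)
  open IndicatorSums R
  open Alg R

  module _ (μ ν : List ℤ) (totalμ : total μ ≡ n) (totalν : total ν ≡ n) (x : Elem) where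
    private
      S₁ S₂ : Shape
      S₁ = shape isPos μ
      S₂ = shape isPos ν
      module Cμ = Compositions μ totalμ
      module Cν = Compositions ν totalν
      open DoubleCosets {μ} {ν} totalμ totalν

    isFactorization : Elem × Elem → Bool
    isFactorization (y , z) = eqE (y · z) x ∧ (inℰ (Gμ μ) y ∧ inℰ (Gμ ν) z)

    factorizations : List (Elem × Elem)
    factorizations = filterᵇ isFactorization (cartesianProduct G G)

    colourings : Elem → List Elem
    colourings d = filterᵇ isT (conjMeet (Gμ (neg μ)) d (Gμ (neg ν)))

    -- Keeping `d` beside each colouring makes the concatenation over all `d` free of repetitions,
    -- although one `τ` can occur for several `d`.
    colouredRepsOver : Elem → List (Elem × Elem)
    colouredRepsOver d = if inℰ (conjMeet (Gμ μ) d (Gμ ν)) x then map (d ,_) (colourings d) else []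

    colouredReps : List (Elem × Elem)
    colouredReps = concatMap colouredRepsOver (D (plus μ) (plus ν))

    ⋆≈length : (E μ ⋆ E ν) x ≈ fromℕ (length factorizations)
    ⋆≈length = R.trans (R.reflexive (cong ΣR (concatMap-cartesianProduct _ G G)))
      (sum-indicator isFactorization (λ (y , z) → if eqE (y · z) x then E μ y *R E ν z else 0#)
        (λ (y , z) → indicator-∧ (eqE (y · z) x) (inℰ (Gμ μ) y) (inℰ (Gμ ν) z)) (cartesianProduct G G))

    RHS≈length : RHS μ ν x ≈ fromℕ (length colouredReps)
    RHS≈length = R.trans (sumRG-at _ (D (plus μ) (plus ν)))
      (sum-concatMap colouredRepsOver _ (λ d → term d (inℰ (conjMeet (Gμ μ) d (Gμ ν)) x)) (D (plus μ) (plus ν)))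
      where
      sumRG-at : ∀ (g : Elem → RG) ds → sumRG (map g ds) x ≈ ΣR (map (λ d → g d x) ds)
      sumRG-at g [] = R.refl
      sumRG-at g (d ∷ ds) = R.+-congˡ (sumRG-at g ds)
      term : ∀ d b → fromℕ (length (colourings d)) *R indicator b
        ≈ fromℕ (length (if b then map (d ,_) (colourings d) else []))
      term d true = R.trans (R.*-identityʳ _) (R.reflexive (cong fromℕ (sym (length-map (d ,_) (colourings d)))))
      term d false = R.zeroʳ _

    factorizations⁻ : ∀ {yz} → yz ∈ factorizations → Factorization S₁ S₂ x yz
    factorizations⁻ {y , z} yz∈ =
      let e , both = T-∧⁻ {eqE (y · z) x} (proj₂ (∈-filterᵇ⁻ isFactorization {xs = cartesianProduct G G} yz∈))
          y∈ , z∈ = T-∧⁻ {inℰ (Gμ μ) y} {inℰ (Gμ ν) z} both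
          gy , ry = inℰ⁻ {S₁} {Gμ μ} {y} Cμ.Gμ-enumerates y∈
          gz , rz = inℰ⁻ {S₂} {Gμ ν} {z} Cν.Gμ-enumerates z∈
      in record { y-InG = gy ; z-InG = gz ; product = eqE⁻ e ; y-reduced = ry ; z-reduced = rz }

    factorizations⁺ : ∀ {yz} → Factorization S₁ S₂ x yz → yz ∈ factorizations
    factorizations⁺ {y , z} F = ∈-filterᵇ⁺ isFactorization (∈-cartesianProduct⁺ (∈G⁺ y-InG) (∈G⁺ z-InG))
      (T-∧⁺ {eqE (y · z) x} (eqE⁺ product) (T-∧⁺ {inℰ (Gμ μ) y} {inℰ (Gμ ν) z}
        (inℰ⁺ {S₁} {Gμ μ} {y} Cμ.Gμ-enumerates y-InG y-reduced)
        (inℰ⁺ {S₂} {Gμ ν} {z} Cν.Gμ-enumerates z-InG z-reduced)))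
      where open Factorization F

    module _ {d : Elem} (rep : DoubleCosetRep S₁ S₂ d) where
      open DoubleCosetRep rep

      stabilizer-enumerates : Enumerates stabilizer (conjMeet (Gμ μ) d (Gμ ν))
      stabilizer-enumerates = conjMeet-enumerates Cμ.Gμ-enumerates Cν.Gμ-enumerates inSn increasing

      opposite-stabilizer-enumerates : Enumerates opposite-stabilizer (conjMeet (Gμ (neg μ)) d (Gμ (neg ν)))
      opposite-stabilizer-enumerates = conjMeet-enumerates Cμ.Gneg-enumerates Cν.Gneg-enumerates inSn increasing

    colouredReps⁻ : ∀ {dτ} → dτ ∈ colouredReps → ColouredRep S₁ S₂ x dτ
    colouredReps⁻ dτ∈ =
      let d , d∈ , h = find (∈-concatMap⁻ colouredRepsOver {xs = D (plus μ) (plus ν)} dτ∈)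
          x∈ , τ , τ∈ , e = ∈-if⁻ (inℰ (conjMeet (Gμ μ) d (Gμ ν)) x) h
          rep = D⁻ d∈
          τ∈′ , isT-τ = ∈-filterᵇ⁻ isT {xs = conjMeet (Gμ (neg μ)) d (Gμ (neg ν))} τ∈
          gx , rx = inℰ⁻ {X = conjMeet (Gμ μ) d (Gμ ν)} {x} (stabilizer-enumerates rep) x∈
      in subst (ColouredRep S₁ S₂ x) (sym e) (record
        { rep = rep ; colouring = proj₁ (opposite-stabilizer-enumerates rep) τ∈′
        ; act-trivial = eqL⁻ isT-τ ; x-InG = gx ; x-reduced = rx })
      where
      ∈-if⁻ : ∀ b {d : Elem} {τs : List Elem} {dτ} → dτ ∈ (if b then map (d ,_) τs else []) →
        T b × ∃ λ τ → τ ∈ τs × dτ ≡ (d , τ)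
      ∈-if⁻ true {d} h = tt , ∈-map⁻ (d ,_) h

    colouredReps⁺ : ∀ {dτ} → ColouredRep S₁ S₂ x dτ → dτ ∈ colouredReps
    colouredReps⁺ {d , τ} C = ∈-concatMap⁺ colouredRepsOver
      (lose (D⁺ rep) (here-τ {inℰ (conjMeet (Gμ μ) d (Gμ ν)) x} (inℰ⁺ {X = conjMeet (Gμ μ) d (Gμ ν)} {x} (stabilizer-enumerates rep) x-InG x-reduced)))
      where
      open ColouredRep C
      here-τ : ∀ {b} → T b → (d , τ) ∈ (if b then map (d ,_) (colourings d) else [])
      here-τ {true} _ = ∈-map⁺ (d ,_) (∈-filterᵇ⁺ isT (proj₂ (opposite-stabilizer-enumerates rep) colouring)
        (subst (λ w → T (eqL w idx)) (sym act-trivial) (eqL⁺ idx)))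

    factorizations-Unique : Unique factorizations
    factorizations-Unique = Uniq.filter⁺ (T? ∘ isFactorization) (Uniq.cartesianProduct⁺ G-Unique G-Unique)

    colouredReps-Unique : Unique colouredReps
    colouredReps-Unique = Unique-concatMap colouredRepsOver proj₁ (D-Unique (plus μ) (plus ν))
      (λ d → fibre-Unique d (inℰ (conjMeet (Gμ μ) d (Gμ ν)) x))
      (λ d → fibre-key d (inℰ (conjMeet (Gμ μ) d (Gμ ν)) x))
      where
      fibre-Unique : ∀ d b → Unique (if b then map (d ,_) (colourings d) else [])
      fibre-Unique d false = []
      fibre-Unique d true = Uniq.map⁺ (λ { refl → refl }) (Uniq.filter⁺ (T? ∘ isT) (Uniq.filter⁺ (T? ∘ _) G-Unique))
      fibre-key : ∀ d b {dτ} → dτ ∈ (if b then map (d ,_) (colourings d) else []) → proj₁ dτ ≡ d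
      fibre-key d true dτ∈ = cong proj₁ (proj₂ (proj₂ (∈-map⁻ (d ,_) dτ∈)))

    length-factorizations≡length-colouredReps : length factorizations ≡ length colouredReps
    length-factorizations≡length-colouredReps = ≤-antisym
      (length-≤-by-relation (Match S₁ S₂ x) factorizations-Unique
        (λ yz∈ → let dτ , C , m = factorization⇒coloured-rep S₁ S₂ x (factorizations⁻ yz∈) in dτ , colouredReps⁺ C , m)
        λ yz∈ yz′∈ dτ∈ → Match-injectiveˡ S₁ S₂ x (colouredReps⁻ dτ∈) (factorizations⁻ yz∈) (factorizations⁻ yz′∈))
      (length-≤-by-relation (λ dτ yz → Match S₁ S₂ x yz dτ) colouredReps-Unique
        (λ dτ∈ → let yz , F , m = coloured-rep⇒factorization S₁ S₂ x (colouredReps⁻ dτ∈) in yz , factorizations⁺ F , m)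
        λ {_} {_} {yz} dτ∈ dτ′∈ _ → Match-injectiveʳ S₁ S₂ x {yz} (colouredReps⁻ dτ∈) (colouredReps⁻ dτ′∈))

    E⋆E≈RHS : (E μ ⋆ E ν) x ≈ RHS μ ν x
    E⋆E≈RHS = R.trans ⋆≈length
      (R.trans (R.reflexive (cong fromℕ length-factorizations≡length-colouredReps)) (R.sym RHS≈length))

theorem6p7 : ∀ {c ℓ} (R : CommutativeRing c ℓ) (r n : ℕ) .{{_ : NonZero r}} → 1 < r → 1 ≤ n →
    (μ ν : List ℤ) → IsSignedComposition n μ → IsSignedComposition n ν →
    ∀ (x : Elem) →
    CommutativeRing._≈_ R
    (Wreath.Alg._⋆_ r n R (Wreath.Alg.E r n R μ) (Wreath.Alg.E r n R ν) x)
    (Wreath.Alg.RHS r n R μ ν x)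
theorem6p7 R r n _ _ μ ν (_ , totalμ) (_ , totalν) x = Multiplication.E⋆E≈RHS R r n μ ν totalμ totalν x
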